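{- Let $\mathcal P$ be a finite chiral polytope. If $|\Gamma^+(\mathcal P) \mathbin{\square} \Gamma^+(\mathcal P^{\delta})| > |\Gamma^+(\mathcal P) \mathbin{\square} \Gamma^+(\overline{\mathcal P})|$, then $\mathcal P \diamond \mathcal P^{\delta}$ is chiral.
   Context: An abstract polytope of rank $n$ (an $n$-polytope) is a ranked poset of faces with ranks from $-1$ to $n$, with a unique least face (rank $-1$) and a unique greatest face (rank $n$), in which every flag (maximal chain) has $n+2$ faces, which satisfies the diamond condition (whenever $F<G$ with ranks $j-1$ and $j+1$ there are exactly two $j$-faces strictly between them), and which is strongly flag-connected (any two flags $\Phi,\Psi$ are joined by a sequence of flags, consecutive ones adjacent, all containing $\Phi\cap\Psi$; two flags are adjacent if they differ in exactly one face). $\Phi^j$ denotes the unique flag differing from $\Phi$ only in its $j$-face, and $\Phi^{i,j}=(\Phi^i)^j$. Each polytope considered has a fixed base flag $\Phi$. $\mathcal P$ is chiral if its automorphism group $\Gamma(\mathcal P)$ has exactly two orbits on flags and adjacent flags lie in distinct orbits; then $\Gamma^+(\mathcal P):=\Gamma(\mathcal P)$ is generated by $\sigma_1,\dots,\sigma_{n-1}$, where $\sigma_i$ maps $\Phi$ to $\Phi^{i,i-1}$. One has $(\sigma_i\cdots\sigma_j)^2=1$ for $i<j$. Let $W^+=\langle \sigma_1,\dots,\sigma_{n-1}\mid (\sigma_i\cdots\sigma_j)^2=1 \text{ for } 1\le i<j\le n-1\rangle$. Writing $\Gamma^+(\mathcal P)=W^+/M$ means that $M$ is the kernel of the epimorphism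 $W^+\to\Gamma^+(\mathcal P)$ preserving the specified generators. For $w\in W^+$, $\overline w$ is obtained by replacing $\sigma_1$ by $\sigma_1^{ -1}$, $\sigma_2$ by $\sigma_1^2\sigma_2$ and fixing $\sigma_j$ for $j\ge3$; $\delta(w)$ is obtained by replacing each $\sigma_i$ by $\sigma_{n-i}^{ -1}$ (both are automorphisms of $W^+$). Put $\overline M=\{\overline w:w\in M\}$, $\delta(M)=\{\delta(w):w\in M\}$. If $\Gamma^+(\mathcal P)=W^+/M$ with $\mathcal P$ chiral, then $\overline M\ne M$; the mirror image $\overline{\mathcal P}$ (same faces, base flag $\Phi^0$) has $\Gamma^+(\overline{\mathcal P})=W^+/\overline M$, and the dual $\mathcal P^\delta$ (reversed order) has $\Gamma^+(\mathcal P^\delta)=W^+/\delta(M)$. Mix and comix: for groups with specified generators $\Gamma=\langle x_1,\dots,x_k\mid R\rangle$, $\Gamma'=\langle x_1',\dots,x_k'\mid S\rangle$, the mix $\Gamma\diamond\Gamma'$ is the subgroup of $\Gamma\times\Gamma'$ generated by $(x_i,x_i')$, $i=1,\dots,k$, and the comix $\Gamma\mathbin{\square}\Gamma'$ is the group $\langle x_1,x_1',\dots,x_k,x_k'\mid R,S,x_1^{ -1}x_1',\dots,x_k^{ -1}x_k'\rangle$. $\mathcal P\diamond\mathcal Q$ is the flag-connected pre-polytope (polytope axioms with strong flag-connectedness weakened to flag-connectedness) built from $\Gamma^+(\mathcal P)\diamond\Gamma^+(\mathcal Q)$; it is handled through $\Gamma^+(\mathcal P\diamond\mathcal Q)=\Gamma^+(\mathcal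 P)\diamond\Gamma^+(\mathcal Q)=W^+/N$, and it is directly regular if $\overline N=N$ and chiral if $\overline N\ne N$ (it need not be polytopal). -}

module Defs where

open import Level using (0ℓ)
open import Algebra.Bundles using (Group)
open import Algebra.Bundles.Raw using (RawGroup)
import Algebra.Construct.DirectProduct as DirectProduct
import Algebra.Morphism.GroupMonomorphism as GroupMonomorphism
open import Algebra.Morphism.Structures using (IsGroupMonomorphism)
open import Data.Empty using (⊥-elim)
open import Data.Fin.Base as Fin using (Fin; zero; suc; toℕ; fromℕ; inject₁; opposite)
import Data.Fin.Properties as Fin
open import Data.Nat.Base as ℕ using (ℕ; zero; suc; _∸_; z≤n; s≤s)
import Data.Nat.Properties as ℕ
open import Data.Product.Base using (Σ; ∃; ∃₂; _×_; _,_; proj₁; proj₂)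
open import Data.Sum.Base using (_⊎_; inj₁; inj₂)
open import Function.Base using (_∘_; id; flip)
open import Function.Bundles using (_↔_; mk↔ₛ′; Inverse)
open import Relation.Binary.Core using (Rel)
import Relation.Binary.Construct.Flip.EqAndOrd as Flip
import Relation.Binary.Construct.StrictToNonStrict as NonStrict
open import Relation.Binary.PropositionalEquality as ≡ using (_≡_; _≢_; refl; sym; trans; cong; subst)
open import Relation.Binary.Structures using (IsStrictPartialOrder)
open import Relation.Nullary using (¬_; yes; no; contradiction)
open import Relation.Unary using (Pred; _≐_)

private
  variable
    n k m : ℕ

opposite-anti-< : {i j : Fin k} → i Fin.< j → opposite j Fin.< opposite i
opposite-anti-< {k} {i} {j} i<j
  rewrite Fin.opposite-prop i | Fin.opposite-prop j
  = ℕ.∸-monoʳ-< (s≤s i<j) (Fin.toℕ<n j)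

opposite-inject₁ : (i : Fin k) → opposite (inject₁ i) ≡ suc (opposite i)
opposite-inject₁ zero    = refl
opposite-inject₁ (suc i) = cong inject₁ (opposite-inject₁ i)

opposite-fromℕ : ∀ k → opposite (fromℕ k) ≡ zero
opposite-fromℕ zero    = refl
opposite-fromℕ (suc k) = cong inject₁ (opposite-fromℕ k)

ascending⇒inflationary : (f : Fin k → Fin m) → (∀ {i j} → i Fin.< j → f i Fin.< f j) →
                         ∀ i → i Fin.≤ f i
ascending⇒inflationary f asc zero = z≤n
ascending⇒inflationary f asc (suc i) = ℕ.≤-<-trans
  (ascending⇒inflationary (f ∘ inject₁) (λ {a} {b} a<b → asc
     (≡.subst₂ ℕ._<_ (sym (Fin.toℕ-inject₁ a)) (sym (Fin.toℕ-inject₁ b)) a<b)) i)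
  (asc (s≤s (ℕ.≤-reflexive (Fin.toℕ-inject₁ i))))

ascending⇒id : (f : Fin k → Fin k) → (∀ {i j} → i Fin.< j → f i Fin.< f j) → ∀ i → f i ≡ i
ascending⇒id f asc i = Fin.toℕ-injective (ℕ.≤-antisym (ℕ.≮⇒≥ i≮fi) (ascending⇒inflationary f asc i))
  where
  i≮fi : ¬ (i Fin.< f i)
  i≮fi i<fi = ℕ.<⇒≱ (opposite-anti-< i<fi)
    (subst (λ l → opposite i Fin.≤ opposite (f l)) (Fin.opposite-involutive i)
      (ascending⇒inflationary (opposite ∘ f ∘ opposite)
        (opposite-anti-< ∘ asc ∘ opposite-anti-<) (opposite i)))

-- The ranks -1, 0, ..., n are encoded, shifted by one, as the elements of
-- Fin (2 + n). For j : Fin n, standing for the proper rank j, the ranks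
-- j - 1, j and j + 1 are encoded by the following three elements.

at-1 at at+1 : Fin n → Fin (2 ℕ.+ n)
at-1 j = inject₁ (inject₁ j)
at   j = suc (inject₁ j)
at+1 j = suc (suc j)

ExactlyTwo : {A : Set} → Pred A 0ℓ → Set
ExactlyTwo {A} Q = ∃₂ λ x y → Q x × Q y × x ≢ y × (∀ z → Q z → z ≡ x ⊎ z ≡ y)

record RankedPoset (n : ℕ) : Set₁ where
  infix 4 _<_
  field
    Face                 : Set
    _<_                  : Rel Face 0ℓ
    isStrictPartialOrder : IsStrictPartialOrder _≡_ _<_
    rank                 : Face → Fin (2 ℕ.+ n)
    rank-mono            : ∀ {F G} → F < G → rank F Fin.< rank G

  open IsStrictPartialOrder isStrictPartialOrder public
    using () renaming (trans to <-trans; irrefl to <-irrefl)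
  open NonStrict _≡_ _<_ public using (_≤_)

  Comparable : Rel Face 0ℓ
  Comparable F G = F ≤ G ⊎ G ≤ F

  -- Chains are finite, being bounded in length by the number of ranks, so a
  -- chain of k faces is given by listing its faces in increasing order.
  record IsMaximalChain {k} (f : Fin k → Face) : Set where
    field
      ascending : ∀ {i j} → i Fin.< j → f i < f j
      maximal   : ∀ G → (∀ i → Comparable G (f i)) → ∃ λ i → f i ≡ G

  -- In a polytope every maximal chain has n + 2 faces, so these are all the
  -- flags; the face with index i is then the one of rank i (rank-face below).
  record Flag : Set where
    field
      face           : Fin (2 ℕ.+ n) → Face
      isMaximalChain : IsMaximalChain face
    open IsMaximalChain isMaximalChain public

    rank-face : ∀ i → rank (face i) ≡ i
    rank-face = ascending⇒id (rank ∘ face) (rank-mono ∘ ascending)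

  open Flag public using (face)

  -- Equality of flags as sets of faces: the maximality proofs are ignored.
  infix 4 _≈ᶠ_
  _≈ᶠ_ : Rel Flag 0ℓ
  Φ ≈ᶠ Ψ = ∀ i → face Φ i ≡ face Ψ i

  infix 4 _∈_
  _∈_ : Face → Flag → Set
  F ∈ Φ = ∃ λ i → face Φ i ≡ F

  DifferAt : Fin (2 ℕ.+ n) → Rel Flag 0ℓ
  DifferAt i Φ Ψ = face Φ i ≢ face Ψ i × (∀ j → j ≢ i → face Φ j ≡ face Ψ j)

  Adjacent : Rel Flag 0ℓ
  Adjacent Φ Ψ = ∃ λ i → DifferAt i Φ Ψ

  data Path (Q : Pred Flag 0ℓ) : Rel Flag 0ℓ where
    done : ∀ {Φ Ψ} → Φ ≈ᶠ Ψ → Path Q Φ Ψ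
    step : ∀ {Φ Λ Ψ} → Adjacent Φ Λ → Q Λ → Path Q Λ Ψ → Path Q Φ Ψ

  ContainsMeet : Flag → Flag → Pred Flag 0ℓ
  ContainsMeet Φ Ψ Λ = ∀ F → F ∈ Φ → F ∈ Ψ → F ∈ Λ

  record IsPolytope : Set where
    field
      least         : Face
      least-≤       : ∀ F → least ≤ F
      rank-least    : rank least ≡ zero
      greatest      : Face
      ≤-greatest    : ∀ F → F ≤ greatest
      rank-greatest : rank greatest ≡ fromℕ (suc n)
      flag-length   : ∀ {k} (f : Fin k → Face) → IsMaximalChain f → k ≡ 2 ℕ.+ n
      diamond       : ∀ j {F G} → F < G → rank F ≡ at-1 j → rank G ≡ at+1 j →
                      ExactlyTwo (λ H → rank H ≡ at j × F < H × H < G)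
      strongly-flag-connected : ∀ Φ Ψ → Path (ContainsMeet Φ Ψ) Φ Ψ

  ascending⇒isMaximalChain : (f : Fin (2 ℕ.+ n) → Face) →
                             (∀ {i j} → i Fin.< j → f i < f j) → IsMaximalChain f
  ascending⇒isMaximalChain f asc = record
    { ascending = asc
    ; maximal   = λ G cmp → rank G , same G (cmp (rank G))
    }
    where
    rank-f : ∀ i → rank (f i) ≡ i
    rank-f = ascending⇒id (rank ∘ f) (rank-mono ∘ asc)

    same : ∀ G → Comparable G (f (rank G)) → f (rank G) ≡ G
    same G (inj₁ (inj₁ G<)) = contradiction (rank-mono G<) (Fin.<-irrefl (sym (rank-f (rank G))))
    same G (inj₁ (inj₂ eq)) = sym eq
    same G (inj₂ (inj₁ <G)) = contradiction (rank-mono <G) (Fin.<-irrefl (rank-f (rank G)))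
    same G (inj₂ (inj₂ eq)) = eq

  record Automorphism : Set where
    field
      permutation : Face ↔ Face
    open Inverse permutation public using (to; from; strictlyInverseˡ; strictlyInverseʳ)
    field
      mono   : ∀ {F G} → F < G → to F < to G
      cancel : ∀ {F G} → to F < to G → F < G

  open Automorphism public using (to; from)

  -- Automorphisms act on the right: first g, then h.
  compose : Automorphism → Automorphism → Automorphism
  compose g h = record
    { permutation = mk↔ₛ′ (to h ∘ to g) (from g ∘ from h)
        (λ F → trans (cong (to h) (g.strictlyInverseˡ _)) (h.strictlyInverseˡ F))
        (λ F → trans (cong (from g) (h.strictlyInverseʳ _)) (g.strictlyInverseʳ F))
    ; mono   = h.mono ∘ g.mono
    ; cancel = g.cancel ∘ h.cancel
    } where module g = Automorphism g
            module h = Automorphism h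

  identity : Automorphism
  identity = record
    { permutation = mk↔ₛ′ id id (λ _ → refl) (λ _ → refl)
    ; mono        = id
    ; cancel      = id
    }

  inverse : Automorphism → Automorphism
  inverse g = record
    { permutation = mk↔ₛ′ (from g) (to g) strictlyInverseʳ strictlyInverseˡ
    ; mono   = λ {F} {G} F<G → cancel
        (≡.subst₂ _<_ (sym (strictlyInverseˡ F)) (sym (strictlyInverseˡ G)) F<G)
    ; cancel = λ {F} {G} F<G →
        ≡.subst₂ _<_ (strictlyInverseˡ F) (strictlyInverseˡ G) (mono F<G)
    } where open Automorphism g hiding (to; from)

  Γ : Group 0ℓ 0ℓ
  Γ = record
    { Carrier = Automorphism
    ; _≈_     = λ g h → ∀ F → to g F ≡ to h F
    ; _∙_     = compose
    ; ε       = identity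
    ; _⁻¹     = inverse
    ; isGroup = record
      { isMonoid = record
        { isSemigroup = record
          { isMagma = record
            { isEquivalence = record
              { refl  = λ _ → refl
              ; sym   = λ e F → sym (e F)
              ; trans = λ d e F → trans (d F) (e F)
              }
            ; ∙-cong = λ {_} {g′} {h} d e F → trans (cong (to h) (d F)) (e (to g′ F))
            }
          ; assoc = λ _ _ _ _ → refl
          }
        ; identity = (λ _ _ → refl) , (λ _ _ → refl)
        }
      ; inverse = Automorphism.strictlyInverseˡ , Automorphism.strictlyInverseʳ
      ; ⁻¹-cong = λ {g} {h} e F →
          trans (cong (from g) (trans (sym (Automorphism.strictlyInverseˡ h F)) (sym (e (from h F)))))
                (Automorphism.strictlyInverseʳ g (from h F))
      }
    }

  infixl 7 _◃_
  _◃_ : Flag → Automorphism → Flag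
  Φ ◃ g = record
    { face           = to g ∘ face Φ
    ; isMaximalChain = ascending⇒isMaximalChain _ (Automorphism.mono g ∘ Flag.ascending Φ)
    }

  SameOrbit : Rel Flag 0ℓ
  SameOrbit Φ Ψ = ∃ λ g → Φ ◃ g ≈ᶠ Ψ

  record IsChiral : Set where
    field
      Φ₁ Φ₂     : Flag
      distinct  : ¬ SameOrbit Φ₁ Φ₂
      covering  : ∀ Ψ → SameOrbit Φ₁ Ψ ⊎ SameOrbit Φ₂ Ψ
      alternate : ∀ Φ Ψ → Adjacent Φ Ψ → ¬ SameOrbit Φ Ψ

  commonOrbit : ∀ Λ Φ Ψ → SameOrbit Λ Φ → SameOrbit Λ Ψ → SameOrbit Φ Ψ
  commonOrbit Λ Φ Ψ (g , p) (h , q) = compose (inverse g) h , λ i →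
    trans (cong (to h) (trans (cong (from g) (sym (p i))) (Automorphism.strictlyInverseʳ g _))) (q i)

  twoSteps : IsChiral → ∀ Φ Λ Ψ → Adjacent Φ Λ → Adjacent Λ Ψ → SameOrbit Φ Ψ
  twoSteps χ Φ Λ Ψ a b = cases (covering Φ) (covering Λ) (covering Ψ)
    where
    open IsChiral χ
    cases : SameOrbit Φ₁ Φ ⊎ SameOrbit Φ₂ Φ → SameOrbit Φ₁ Λ ⊎ SameOrbit Φ₂ Λ →
            SameOrbit Φ₁ Ψ ⊎ SameOrbit Φ₂ Ψ → SameOrbit Φ Ψ
    cases (inj₁ p) _        (inj₁ r) = commonOrbit Φ₁ Φ Ψ p r
    cases (inj₂ p) _        (inj₂ r) = commonOrbit Φ₂ Φ Ψ p r
    cases (inj₁ p) (inj₁ q) (inj₂ _) = ⊥-elim (alternate Φ Λ a (commonOrbit Φ₁ Φ Λ p q))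
    cases (inj₁ _) (inj₂ q) (inj₂ r) = ⊥-elim (alternate Λ Ψ b (commonOrbit Φ₂ Λ Ψ q r))
    cases (inj₂ p) (inj₂ q) (inj₁ _) = ⊥-elim (alternate Φ Λ a (commonOrbit Φ₂ Φ Λ p q))
    cases (inj₂ _) (inj₁ q) (inj₁ r) = ⊥-elim (alternate Λ Ψ b (commonOrbit Φ₁ Λ Ψ q r))

  face-≤ : ∀ Φ {i j} → i Fin.≤ j → face Φ i ≤ face Φ j
  face-≤ Φ {i} {j} i≤j with ℕ.m≤n⇒m<n∨m≡n i≤j
  ... | inj₁ i<j = inj₁ (Flag.ascending Φ i<j)
  ... | inj₂ i≡j = inj₂ (cong (face Φ) (Fin.toℕ-injective i≡j))

  <-≤-trans : ∀ {F G H} → F < G → G ≤ H → F < H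
  <-≤-trans F<G (inj₁ G<H)  = <-trans F<G G<H
  <-≤-trans F<G (inj₂ refl) = F<G

  ≤-<-trans : ∀ {F G H} → F ≤ G → G < H → F < H
  ≤-<-trans (inj₁ F<G)  G<H = <-trans F<G G<H
  ≤-<-trans (inj₂ refl) G<H = G<H

  replace : (Fin (2 ℕ.+ n) → Face) → Fin n → Face → Fin (2 ℕ.+ n) → Face
  replace f j H i with i Fin.≟ at j
  ... | yes _ = H
  ... | no  _ = f i

  replace-at : ∀ f j H → replace f j H (at j) ≡ H
  replace-at f j H with at j Fin.≟ at j
  ... | yes _   = refl
  ... | no  neq = contradiction refl neq

  replace-off : ∀ f j H i → i ≢ at j → replace f j H i ≡ f i
  replace-off f j H i i≢ with i Fin.≟ at j
  ... | yes eq = contradiction eq i≢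
  ... | no  _  = refl

  replaceFace : ∀ Φ j H → face Φ (at-1 j) < H → H < face Φ (at+1 j) → Flag
  replaceFace Φ j H F<H H<G = record
    { face           = replace (face Φ) j H
    ; isMaximalChain = ascending⇒isMaximalChain _ asc
    }
    where
    asc : ∀ {a b} → a Fin.< b → replace (face Φ) j H a < replace (face Φ) j H b
    asc {a} {b} a<b with a Fin.≟ at j | b Fin.≟ at j
    ... | no  _    | no  _    = Flag.ascending Φ a<b
    ... | yes refl | yes refl = contradiction a<b (Fin.<-irrefl refl)
    ... | yes refl | no  _    = <-≤-trans H<G (face-≤ Φ
            (subst (λ l → suc (suc l) ℕ.≤ toℕ b) (Fin.toℕ-inject₁ j) a<b))
    ... | no  _    | yes refl = ≤-<-trans (face-≤ Φ
            (subst (toℕ a ℕ.≤_) (sym (Fin.toℕ-inject₁ (inject₁ j))) (ℕ.s≤s⁻¹ a<b))) F<H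

  module FlagExchange (isPolytope : IsPolytope) where
    open IsPolytope isPolytope

    between : ∀ Φ j → face Φ (at-1 j) < face Φ (at j) × face Φ (at j) < face Φ (at+1 j)
    between Φ j =
        Flag.ascending Φ (s≤s (ℕ.≤-reflexive (Fin.toℕ-inject₁ (inject₁ j))))
      , Flag.ascending Φ (s≤s (s≤s (ℕ.≤-reflexive (Fin.toℕ-inject₁ j))))

    otherFace : ∀ Φ j → ∃ λ H → face Φ (at j) ≢ H × face Φ (at-1 j) < H × H < face Φ (at+1 j)
    otherFace Φ j
      with between Φ j
    ... | lo , hi
      with diamond j (<-trans lo hi) (Flag.rank-face Φ _) (Flag.rank-face Φ _)
    ... | x , y , (_ , x>F , x<G) , (_ , y>F , y<G) , x≢y , only
      with only (face Φ (at j)) (Flag.rank-face Φ _ , lo , hi)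
    ... | inj₁ eq = y , (λ e → x≢y (trans (sym eq) e)) , y>F , y<G
    ... | inj₂ eq = x , (λ e → x≢y (trans (sym e) eq)) , x>F , x<G

    infixl 8 _^_
    _^_ : Flag → Fin n → Flag
    Φ ^ j with otherFace Φ j
    ... | H , _ , F<H , H<G = replaceFace Φ j H F<H H<G

    ^-differ : ∀ Φ j → DifferAt (at j) Φ (Φ ^ j)
    ^-differ Φ j with otherFace Φ j
    ... | H , ≢H , _ = (λ e → ≢H (trans e (replace-at (face Φ) j H)))
                     , (λ i i≢ → sym (replace-off (face Φ) j H i i≢))

    ^-adjacent : ∀ Φ j → Adjacent Φ (Φ ^ j)
    ^-adjacent Φ j = at j , ^-differ Φ j

record ChiralPolytope (n : ℕ) : Set₁ where
  field
    rankedPoset : RankedPoset n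
  open RankedPoset rankedPoset public
  field
    isPolytope : IsPolytope
    isChiral   : IsChiral
    base       : Flag
  open IsPolytope isPolytope public
  open FlagExchange isPolytope public

Finite : ChiralPolytope n → Set
Finite P = ∃ λ m → ChiralPolytope.Face P ↔ Fin m

module _ (R : RankedPoset n) where
  private
    open module R = RankedPoset R using (Face; _<_; face)

  dualPoset : RankedPoset n
  dualPoset = record
    { Face                 = Face
    ; _<_                  = flip _<_
    ; isStrictPartialOrder = Flip.isStrictPartialOrder R.isStrictPartialOrder
    ; rank                 = opposite ∘ R.rank
    ; rank-mono            = opposite-anti-< ∘ R.rank-mono
    }

  private
    module D = RankedPoset dualPoset

  toDual : R.Flag → D.Flag
  toDual Φ = record
    { face           = face Φ ∘ opposite
    ; isMaximalChain = D.ascending⇒isMaximalChain _ (R.Flag.ascending Φ ∘ opposite-anti-<)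
    }

  fromDual : D.Flag → R.Flag
  fromDual Φ = record
    { face           = D.face Φ ∘ opposite
    ; isMaximalChain = R.ascending⇒isMaximalChain _ (D.Flag.ascending Φ ∘ opposite-anti-<)
    }

  private
    opp² : (f : Fin k → Face) → ∀ i → f (opposite (opposite i)) ≡ f i
    opp² f i = cong f (Fin.opposite-involutive i)

    swap≤ : ∀ {F G} → F R.≤ G → G D.≤ F
    swap≤ (inj₁ F<G) = inj₁ F<G
    swap≤ (inj₂ F≡G) = inj₂ (sym F≡G)

    swapComparable : ∀ {F G} → F R.≤ G ⊎ G R.≤ F → D.Comparable F G
    swapComparable (inj₁ p) = inj₂ (swap≤ p)
    swapComparable (inj₂ p) = inj₁ (swap≤ p)

    dualChain : {f : Fin k → Face} → D.IsMaximalChain f → R.IsMaximalChain (f ∘ opposite)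
    dualChain {f = f} c = record
      { ascending = D.IsMaximalChain.ascending c ∘ opposite-anti-<
      ; maximal   = λ G cmp →
          let i , eq = D.IsMaximalChain.maximal c G
                (λ i → subst (D.Comparable G) (opp² f i) (swapComparable (cmp (opposite i))))
          in opposite i , trans (opp² f i) eq
      }

    ∈-fromDual : ∀ {F} Φ → F D.∈ Φ → F R.∈ fromDual Φ
    ∈-fromDual Φ (i , eq) = opposite i , trans (opp² (D.face Φ) i) eq

    ∈-toDual : ∀ {F} Φ → F R.∈ Φ → F D.∈ toDual Φ
    ∈-toDual Φ (i , eq) = opposite i , trans (opp² (face Φ) i) eq

    opposite-≢ : {i j : Fin k} → j ≢ opposite i → opposite j ≢ i
    opposite-≢ {j = j} j≢ e = j≢ (trans (sym (Fin.opposite-involutive j)) (cong opposite e))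

    adjacentToDual : ∀ Φ Ψ → R.Adjacent Φ Ψ → D.Adjacent (toDual Φ) (toDual Ψ)
    adjacentToDual Φ Ψ (i , neq , same) = opposite i
      , (λ e → neq (trans (sym (opp² (face Φ) i)) (trans e (opp² (face Ψ) i))))
      , (λ j j≢ → same (opposite j) (opposite-≢ j≢))

    adjacentFromDual : ∀ Φ Ψ → D.Adjacent Φ Ψ → R.Adjacent (fromDual Φ) (fromDual Ψ)
    adjacentFromDual Φ Ψ (i , neq , same) = opposite i
      , (λ e → neq (trans (sym (opp² (D.face Φ) i)) (trans e (opp² (D.face Ψ) i))))
      , (λ j j≢ → same (opposite j) (opposite-≢ j≢))

    adjacent-resp : ∀ Φ Φ′ Ψ → Φ D.≈ᶠ Φ′ → D.Adjacent Φ′ Ψ → D.Adjacent Φ Ψ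
    adjacent-resp Φ Φ′ Ψ e (i , neq , same) =
      i , (λ d → neq (trans (sym (e i)) d)) , (λ j j≢ → trans (e j) (same j j≢))

    dualPath : ∀ Φ Ψ {A B} → R.Path (R.ContainsMeet (fromDual Φ) (fromDual Ψ)) A B →
               ∀ A′ B′ → A′ D.≈ᶠ toDual A → toDual B D.≈ᶠ B′ →
               D.Path (D.ContainsMeet Φ Ψ) A′ B′
    dualPath Φ Ψ (R.done e) A′ B′ p q = D.done (λ i → trans (p i) (trans (e (opposite i)) (q i)))
    dualPath Φ Ψ (R.step {A} {Λ} adj c path) A′ B′ p q = D.step
      (adjacent-resp A′ (toDual A) (toDual Λ) p (adjacentToDual A Λ adj))
      (λ F F∈Φ F∈Ψ → ∈-toDual Λ (c F (∈-fromDual Φ F∈Φ) (∈-fromDual Ψ F∈Ψ)))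
      (dualPath Φ Ψ path (toDual Λ) B′ (λ _ → refl) q)

    rank-dual : ∀ {F : Face} {r s} → opposite (R.rank F) ≡ r → opposite r ≡ s → R.rank F ≡ s
    rank-dual {F} p q = trans (sym (Fin.opposite-involutive (R.rank F))) (trans (cong opposite p) q)

    opposite-at : (j : Fin n) → opposite (at j) ≡ at (opposite j)
    opposite-at j = cong inject₁ (opposite-inject₁ j)

    opposite-at-1 : (j : Fin n) → opposite (at-1 j) ≡ at+1 (opposite j)
    opposite-at-1 j = trans (opposite-inject₁ (inject₁ j)) (cong suc (opposite-inject₁ j))

    opposite-at-opposite : (j : Fin n) → opposite (at (opposite j)) ≡ at j
    opposite-at-opposite j = trans (opposite-at (opposite j)) (cong at (Fin.opposite-involutive j))

  dualIsPolytope : R.IsPolytope → D.IsPolytope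
  dualIsPolytope isP = record
    { least         = P.greatest
    ; least-≤       = λ F → swap≤ (P.≤-greatest F)
    ; rank-least    = trans (cong opposite P.rank-greatest) (opposite-fromℕ (suc n))
    ; greatest      = P.least
    ; ≤-greatest    = λ F → swap≤ (P.least-≤ F)
    ; rank-greatest = cong opposite P.rank-least
    ; flag-length   = λ f c → P.flag-length (f ∘ opposite) (dualChain c)
    ; diamond       = λ j F>G rF rG →
        let x , y , (rx , G<x , x<F) , (ry , G<y , y<F) , x≢y , only =
              P.diamond (opposite j) F>G (rank-dual rG refl) (rank-dual rF (opposite-at-1 j))
        in x , y
         , (trans (cong opposite rx) (opposite-at-opposite j) , x<F , G<x)
         , (trans (cong opposite ry) (opposite-at-opposite j) , y<F , G<y)
         , x≢y
         , λ z (rz , z<F , G<z) → only z (rank-dual rz (opposite-at j) , G<z , z<F)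
    ; strongly-flag-connected = λ Φ Ψ →
        dualPath Φ Ψ (P.strongly-flag-connected (fromDual Φ) (fromDual Ψ)) Φ Ψ
          (λ i → sym (opp² (D.face Φ) i)) (opp² (D.face Ψ))
    } where module P = R.IsPolytope isP

  automorphismToDual : R.Automorphism → D.Automorphism
  automorphismToDual g = record { permutation = permutation ; mono = mono ; cancel = cancel }
    where open R.Automorphism g

  automorphismFromDual : D.Automorphism → R.Automorphism
  automorphismFromDual g = record { permutation = permutation ; mono = mono ; cancel = cancel }
    where open D.Automorphism g

  dualIsChiral : R.IsChiral → D.IsChiral
  dualIsChiral χ = record
    { Φ₁        = toDual Φ₁
    ; Φ₂        = toDual Φ₂
    ; distinct  = λ (g , e) → distinct (automorphismFromDual g , λ i →
        trans (cong (D.to g) (sym (opp² (face Φ₁) i))) (trans (e (opposite i)) (opp² (face Φ₂) i)))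
    ; covering  = λ Ψ → cover Ψ (covering (fromDual Ψ))
    ; alternate = λ Φ Ψ adj (g , e) → alternate (fromDual Φ) (fromDual Ψ) (adjacentFromDual Φ Ψ adj)
        (automorphismFromDual g , λ i → e (opposite i))
    }
    where
    open R.IsChiral χ
    lift : ∀ Λ Ψ → R.SameOrbit Λ (fromDual Ψ) → D.SameOrbit (toDual Λ) Ψ
    lift Λ Ψ (g , e) = automorphismToDual g , λ i → trans (e (opposite i)) (opp² (D.face Ψ) i)
    cover : ∀ Ψ → R.SameOrbit Φ₁ (fromDual Ψ) ⊎ R.SameOrbit Φ₂ (fromDual Ψ) →
            D.SameOrbit (toDual Φ₁) Ψ ⊎ D.SameOrbit (toDual Φ₂) Ψ
    cover Ψ (inj₁ p) = inj₁ (lift Φ₁ Ψ p)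
    cover Ψ (inj₂ p) = inj₂ (lift Φ₂ Ψ p)

infix 9 _ᵟ
_ᵟ : ChiralPolytope n → ChiralPolytope n
P ᵟ = record
  { rankedPoset = dualPoset rankedPoset
  ; isPolytope  = dualIsPolytope rankedPoset isPolytope
  ; isChiral    = dualIsChiral rankedPoset isChiral
  ; base        = toDual rankedPoset base
  } where open ChiralPolytope P

-- A flag of a polytope of rank 0 has no 0-adjacent flag. The first clause is
-- a mere convention: there is only one flag then, so no chiral polytope.
mirrorBase : (P : ChiralPolytope n) → ChiralPolytope.Flag P
mirrorBase {zero}  P = ChiralPolytope.base P
mirrorBase {suc _} P = base ^ zero where open ChiralPolytope P

mirror : ChiralPolytope n → ChiralPolytope n
mirror P = record
  { rankedPoset = rankedPoset
  ; isPolytope  = isPolytope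
  ; isChiral    = isChiral
  ; base        = mirrorBase P
  } where open ChiralPolytope P

infixl 7 _∙_
infix  8 _⁻¹

data Word (X : Set) : Set where
  gen : X → Word X
  ε   : Word X
  _∙_ : Word X → Word X → Word X
  _⁻¹ : Word X → Word X

substitute : {X Y : Set} → (X → Word Y) → Word X → Word Y
substitute s (gen x) = s x
substitute s ε       = ε
substitute s (v ∙ w) = substitute s v ∙ substitute s w
substitute s (w ⁻¹)  = substitute s w ⁻¹

rename : {X Y : Set} → (X → Y) → Word X → Word Y
rename r = substitute (gen ∘ r)

infix 4 _⊢_≈_

data _⊢_≈_ {X : Set} (R : Pred (Word X) 0ℓ) : Rel (Word X) 0ℓ where
  relator   : ∀ {w} → R w → R ⊢ w ≈ ε
  reflexive : ∀ {w} → R ⊢ w ≈ w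
  symmetric : ∀ {v w} → R ⊢ v ≈ w → R ⊢ w ≈ v
  transit   : ∀ {u v w} → R ⊢ u ≈ v → R ⊢ v ≈ w → R ⊢ u ≈ w
  ∙-cong    : ∀ {v v′ w w′} → R ⊢ v ≈ v′ → R ⊢ w ≈ w′ → R ⊢ v ∙ w ≈ v′ ∙ w′
  ⁻¹-cong   : ∀ {w w′} → R ⊢ w ≈ w′ → R ⊢ w ⁻¹ ≈ w′ ⁻¹
  assoc     : ∀ u v w → R ⊢ (u ∙ v) ∙ w ≈ u ∙ (v ∙ w)
  identityˡ : ∀ w → R ⊢ ε ∙ w ≈ w
  identityʳ : ∀ w → R ⊢ w ∙ ε ≈ w
  inverseˡ  : ∀ w → R ⊢ w ⁻¹ ∙ w ≈ ε
  inverseʳ  : ∀ w → R ⊢ w ∙ w ⁻¹ ≈ ε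

⟨_∣_⟩ : (X : Set) → Pred (Word X) 0ℓ → Group 0ℓ 0ℓ
⟨ X ∣ R ⟩ = record
  { Carrier = Word X
  ; _≈_     = R ⊢_≈_
  ; _∙_     = _∙_
  ; ε       = ε
  ; _⁻¹     = _⁻¹
  ; isGroup = record
    { isMonoid = record
      { isSemigroup = record
        { isMagma = record
          { isEquivalence = record { refl = reflexive ; sym = symmetric ; trans = transit }
          ; ∙-cong        = ∙-cong
          }
        ; assoc = assoc
        }
      ; identity = identityˡ , identityʳ
      }
    ; inverse = inverseˡ , inverseʳ
    ; ⁻¹-cong = ⁻¹-cong
    }
  }

HasOrder : Group 0ℓ 0ℓ → ℕ → Set
HasOrder G k = Inverse (Group.setoid G) (≡.setoid (Fin k))

record MarkedGroup (k : ℕ) : Set₁ where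
  field
    group : Group 0ℓ 0ℓ
  open Group group public using (Carrier; rawGroup) renaming (_≈_ to _≋_)
  field
    generator : Fin k → Carrier

  evaluate : Word (Fin k) → Carrier
  evaluate (gen i) = generator i
  evaluate ε       = Group.ε group
  evaluate (v ∙ w) = Group._∙_ group (evaluate v) (evaluate w)
  evaluate (w ⁻¹)  = Group._⁻¹ group (evaluate w)

  -- The words in the generators of W⁺ k are the elements of W⁺ k, so for a
  -- rotation group this is the kernel of the epimorphism from W⁺ k.
  Kernel : Pred (Word (Fin k)) 0ℓ
  Kernel w = evaluate w ≋ Group.ε group

generatedSubgroup : MarkedGroup k → MarkedGroup k
generatedSubgroup {k} G = record
  { group = record
    { RawGroup sub
    ; isGroup = GroupMonomorphism.isGroup inclusion (Group.isGroup group)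
    }
  ; generator = λ i → generator i , gen i , Group.refl group
  }
  where
  open MarkedGroup G
  module G = Group group
  sub : RawGroup 0ℓ 0ℓ
  sub = record
    { Carrier = Σ Carrier λ g → ∃ λ w → evaluate w ≋ g
    ; _≈_     = λ x y → proj₁ x ≋ proj₁ y
    ; _∙_     = λ (g , v , p) (h , w , q) → g G.∙ h , v ∙ w , G.∙-cong p q
    ; ε       = G.ε , ε , G.refl
    ; _⁻¹     = λ (g , w , p) → g G.⁻¹ , w ⁻¹ , G.⁻¹-cong p
    }
  inclusion : IsGroupMonomorphism sub rawGroup proj₁
  inclusion = record
    { isGroupHomomorphism = record
      { isMonoidHomomorphism = record
        { isMagmaHomomorphism = record
          { isRelHomomorphism = record { cong = id }
          ; homo = λ _ _ → G.refl
          }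
        ; ε-homo = G.refl
        }
      ; ⁻¹-homo = λ _ → G.refl
      }
    ; injective = id
    }

infixl 7 _⋄_ _□_

_⋄_ : MarkedGroup k → MarkedGroup k → MarkedGroup k
G ⋄ H = generatedSubgroup record
  { group     = DirectProduct.group (MarkedGroup.group G) (MarkedGroup.group H)
  ; generator = λ i → MarkedGroup.generator G i , MarkedGroup.generator H i
  }

-- The relators R and S are taken to be all words that are trivial in the
-- respective group; any other presentations on the same generators give the
-- same normal closure.
data ComixRelator (G H : MarkedGroup k) : Pred (Word (Fin k ⊎ Fin k)) 0ℓ where
  left     : ∀ {w} → MarkedGroup.Kernel G w → ComixRelator G H (rename inj₁ w)
  right    : ∀ {w} → MarkedGroup.Kernel H w → ComixRelator G H (rename inj₂ w)
  identify : ∀ i → ComixRelator G H (gen (inj₁ i) ⁻¹ ∙ gen (inj₂ i))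

_□_ : MarkedGroup k → MarkedGroup k → Group 0ℓ 0ℓ
_□_ {k} G H = ⟨ Fin k ⊎ Fin k ∣ ComixRelator G H ⟩

-- The generators σ₁, ..., σₙ₋₁ are indexed by Fin (n ∸ 1): index i stands for
-- σᵢ₊₁, which maps the base flag to its image under ^ i+1 followed by ^ i.

upper lower : Fin (n ∸ 1) → Fin n
upper {suc _} i = suc i
lower {suc _} i = inject₁ i

module _ (P : ChiralPolytope n) where
  open ChiralPolytope P

  σ-exists : ∀ i → SameOrbit base (base ^ upper i ^ lower i)
  σ-exists i = twoSteps isChiral base (base ^ upper i) (base ^ upper i ^ lower i)
    (^-adjacent base (upper i)) (^-adjacent (base ^ upper i) (lower i))

  σ : Fin (n ∸ 1) → Automorphism
  σ i = proj₁ (σ-exists i)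

  Γ⁺ : MarkedGroup (n ∸ 1)
  Γ⁺ = record { group = Γ ; generator = σ }

-- σᵢ ∙ ... ∙ σⱼ for i ≤ j (and ε otherwise)
σ[_⋯_] : Fin k → Fin k → Word (Fin k)
σ[ zero  ⋯ zero  ] = gen zero
σ[_⋯_] {suc (suc _)} zero (suc j) = gen zero ∙ rename suc σ[ zero ⋯ j ]
σ[ suc i ⋯ zero  ] = ε
σ[ suc i ⋯ suc j ] = rename suc σ[ i ⋯ j ]

data W⁺Relator {k} : Pred (Word (Fin k)) 0ℓ where
  square : ∀ {i j} → i Fin.< j → W⁺Relator (σ[ i ⋯ j ] ∙ σ[ i ⋯ j ])

-- For polytopes of rank n, k = n ∸ 1.
W⁺ : ℕ → Group 0ℓ 0ℓ
W⁺ k = ⟨ Fin k ∣ W⁺Relator ⟩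

barGenerator : Fin k → Word (Fin k)
barGenerator zero          = gen zero ⁻¹
barGenerator (suc zero)    = gen zero ∙ gen zero ∙ gen (suc zero)
barGenerator (suc (suc j)) = gen (suc (suc j))

bar : Word (Fin k) → Word (Fin k)
bar = substitute barGenerator

barImage : Pred (Word (Fin k)) 0ℓ → Pred (Group.Carrier (W⁺ k)) 0ℓ
barImage {k} N w = ∃ λ v → N v × Group._≈_ (W⁺ k) w (bar v)

-- Chirality of the pre-polytope with rotation group G = W⁺/N.
RotationGroupChiral : MarkedGroup k → Set
RotationGroupChiral G = ¬ (barImage N ≐ N)
  where N = MarkedGroup.Kernel G

MixIsChiral : ChiralPolytope n → ChiralPolytope n → Set
MixIsChiral P Q = RotationGroupChiral (Γ⁺ P ⋄ Γ⁺ Q)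

{-# OPTIONS --safe #-}

-- Let M, δM and M̄ be the kernels of W⁺ onto the rotation groups of P, of its
-- dual and of its mirror image. If N = M ∩ δM were invariant under bar, then
-- N ⊆ M ∩ M̄, so M/(M ∩ M̄) would be a quotient of M/N. As |W⁺/δM| = |W⁺/M̄| is
-- finite and equals both a · |M/N| and b · |M/(M ∩ M̄)|, where a and b are the
-- orders of the two comixes, this forces a ≤ b.
--
-- Constructively, M/N is not known to have an order, but it embeds into a finite set.
-- The argument yields an embedding of a copies of M/N into b copies, and
-- iterating this embedding gives aᵏ ≤ bᵏ C for a fixed C and all k.

module Submission where

open import Defs
open import Level using (0ℓ)
open import Algebra.Bundles using (Group)
import Algebra.Morphism.Construct.Identity as Identity
open import Algebra.Morphism.Structures using (IsGroupHomomorphism)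
import Algebra.Properties.Group as GroupProperties
open import Data.Empty using (⊥)
open import Data.Fin.Base as Fin using (Fin; zero; suc; toℕ; fromℕ; inject₁; opposite; combine; remQuot; funToFin; finToFun)
import Data.Fin.Properties as Fin
open import Data.Fin.Relation.Unary.Top using (view; ‵fromℕ; ‵inject₁)
open import Data.Nat as ℕ using (ℕ; zero; suc; _+_; _*_; _∸_; _>_; NonZero; >-nonZero⁻¹; s≤s; z≤n)
import Data.Nat.Properties as ℕ
open import Data.Nat.Tactic.RingSolver using (solve-∀)
open import Data.Product.Base using (Σ; ∃; _×_; _,_; proj₁; proj₂)
open import Data.Product.Relation.Binary.Pointwise.NonDependent using (Pointwise)
open import Data.Sum.Base using (_⊎_; inj₁; inj₂; [_,_]′)
open import Data.Vec.Functional using (_∷_; tail)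
open import Function.Base using (_∘_; id; _on_)
open import Function.Bundles using (Inverse)
open import Function.Definitions using (Injective)
open import Function.Properties.Inverse using (↔⇒↣)
open import Relation.Binary.Bundles using (Setoid)
open import Relation.Binary.Core using (Rel)
open import Relation.Binary.Definitions using (DecidableEquality)
open import Relation.Binary.PropositionalEquality using (_≡_; _≢_; refl; sym; trans; cong; cong₂; subst; subst₂)
import Relation.Binary.Reasoning.Setoid as SetoidReasoning
open import Relation.Nullary using (¬_; yes; no; contradiction)
open import Relation.Nullary.Decidable using (decidable-stable; via-injection)

-- Cancellation of a finite factor

-- Bernoulli's inequality (1 + 1/b)^k ≥ 1 + k/b, cleared of denominators and with `suc b` weakened
-- to `a`.
bernoulli : ∀ {a b} → b ℕ.< a → ∀ k → b ℕ.^ k * (b + k) ℕ.≤ a ℕ.^ k * b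
bernoulli {a} {b} b<a zero = ℕ.≤-reflexive (cong (1 *_) (ℕ.+-identityʳ b))
bernoulli {a} {b} b<a (suc k) = begin
  b * b ℕ.^ k * (b + suc k)         ≡⟨ lhs b k (b ℕ.^ k) ⟩
  b ℕ.^ k * (b * (b + k) + b)       ≤⟨ ℕ.*-monoʳ-≤ (b ℕ.^ k) (ℕ.+-monoʳ-≤ (b * (b + k)) (ℕ.m≤m+n b k)) ⟩
  b ℕ.^ k * (b * (b + k) + (b + k)) ≡⟨ mid b k (b ℕ.^ k) ⟩
  suc b * (b ℕ.^ k * (b + k))       ≤⟨ ℕ.*-mono-≤ b<a (bernoulli b<a k) ⟩
  a * (a ℕ.^ k * b)                 ≡⟨ ℕ.*-assoc a (a ℕ.^ k) b ⟨
  a * a ℕ.^ k * b                   ∎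
  where
  open ℕ.≤-Reasoning
  lhs : ∀ b k p → b * p * (b + suc k) ≡ p * (b * (b + k) + b)
  lhs = solve-∀
  mid : ∀ b k p → p * (b * (b + k) + (b + k)) ≡ suc b * (p * (b + k))
  mid = solve-∀

-- If `b < a`, the ratio of the k-th powers is at least 1 + k/b; at the exponent `b * M` this is 1 +
-- M, which exceeds the bound `M`.
powers-dominated⇒≤ : ∀ a b M .{{_ : NonZero b}} → (∀ k → a ℕ.^ k ℕ.≤ b ℕ.^ k * M) → a ℕ.≤ b
powers-dominated⇒≤ a b M dominated = ℕ.≮⇒≥ λ b<a → ℕ.<⇒≱
  (ℕ.m<n+m (b * M) (>-nonZero⁻¹ b))
  (ℕ.*-cancelˡ-≤ (b ℕ.^ (b * M)) {{ℕ.m^n≢0 b (b * M)}} (begin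
    b ℕ.^ (b * M) * (b + b * M) ≤⟨ bernoulli b<a (b * M) ⟩
    a ℕ.^ (b * M) * b           ≤⟨ ℕ.*-monoˡ-≤ b (dominated (b * M)) ⟩
    b ℕ.^ (b * M) * M * b       ≡⟨ ℕ.*-assoc (b ℕ.^ (b * M)) M b ⟩
    b ℕ.^ (b * M) * (M * b)     ≡⟨ cong (b ℕ.^ (b * M) *_) (ℕ.*-comm M b) ⟩
    b ℕ.^ (b * M) * (b * M)     ∎))
  where open ℕ.≤-Reasoning

module _ {X : Set} {_~_ : Rel X 0ℓ} where

  infix 4 _≈ₓ_
  _≈ₓ_ : ∀ {p} → Rel (Fin p × X) 0ℓ
  _≈ₓ_ = Pointwise _≡_ _~_

  module _ {a b} (f : Fin a × X → Fin b × X) (f-injective : Injective _≈ₓ_ _≈ₓ_ f) where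

    -- An index below a^k is read as k digits in base a. Each step feeds one digit and the current
    -- element of `X` to `f`, keeps the base-b digit that comes out and passes the new element on.
    iterate : ∀ k → Fin (a ℕ.^ k) × X → Fin (b ℕ.^ k) × X
    iterate zero    s       = s
    iterate (suc k) (i , x) =
      let q , r  = remQuot {a} (a ℕ.^ k) i
          j , y  = f (q , x)
          j′ , z = iterate k (r , y)
      in combine j j′ , z

    iterate-injective : ∀ k → Injective _≈ₓ_ _≈ₓ_ (iterate k)
    iterate-injective zero    e = e
    iterate-injective (suc k) {i , x} {i′ , x′} (same , z~z′) =
      let j≡j′ , l≡l′  = Fin.combine-injective _ _ _ _ same
          r≡r′ , y~y′  = iterate-injective k (l≡l′ , z~z′)
          q≡q′ , x~x′  = f-injective (j≡j′ , y~y′)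
      in trans (sym (Fin.combine-remQuot {a} (a ℕ.^ k) i))
           (trans (cong₂ combine q≡q′ r≡r′) (Fin.combine-remQuot {a} (a ℕ.^ k) i′))
       , x~x′

    -- There is no known order of `X` to divide by, but starting every iteration at the same `x`
    -- embeds a^k indices into b^k digit strings times `M` codes. The point `x` excludes an empty
    -- `X`, for which `f` would give no bound.
    cancel-finite : ∀ {M} (code : X → Fin M) → Injective _~_ _≡_ code →
                    X → .{{_ : NonZero b}} → a ℕ.≤ b
    cancel-finite {M} code code-injective x = powers-dominated⇒≤ a b M λ k →
      Fin.injective⇒≤ {f = λ i → tag k i} λ {i} {j} e →
        let l , c = Fin.combine-injective _ _ _ _ e
        in proj₁ (iterate-injective k {i , x} {j , x} (l , code-injective c))
      where
      tag : ∀ k → Fin (a ℕ.^ k) → Fin (b ℕ.^ k * M)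
      tag k i = let j , y = iterate k (i , x) in combine j (code y)

-- Words in mixes and comixes

module _ {k} (G H : MarkedGroup k) {φ : MarkedGroup.Carrier H → MarkedGroup.Carrier G}
         (homo : IsGroupHomomorphism (MarkedGroup.rawGroup H) (MarkedGroup.rawGroup G) φ) where
  private
    module G = MarkedGroup G
    module H = MarkedGroup H
    module Γ = Group G.group
    module φ = IsGroupHomomorphism homo

  -- Both sides are homomorphic in `w`, so the generators decide. This translates words between the
  -- rotation groups of `P`, its dual and its mirror image.
  evaluate-substitute : (s : Fin k → Word (Fin k)) → (∀ i → φ (H.generator i) G.≋ G.evaluate (s i)) →
                        ∀ w → φ (H.evaluate w) G.≋ G.evaluate (substitute s w)
  evaluate-substitute s e (gen i) = e i
  evaluate-substitute s e ε       = φ.ε-homo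
  evaluate-substitute s e (v ∙ w) = Γ.trans (φ.homo _ _)
    (Γ.∙-cong (evaluate-substitute s e v) (evaluate-substitute s e w))
  evaluate-substitute s e (w ⁻¹)  = Γ.trans (φ.⁻¹-homo _) (Γ.⁻¹-cong (evaluate-substitute s e w))

module _ {k} (G H : MarkedGroup k) where
  private
    module G = MarkedGroup G
    module H = MarkedGroup H
    module ΓG = Group G.group
    module ΓH = Group H.group
    module M = MarkedGroup (G ⋄ H)

  -- Elements of the mix also carry a word witnessing membership; equality in the mix sees only the
  -- pair computed here.
  mix-evaluate : ∀ w → proj₁ (M.evaluate w) ≡ (G.evaluate w , H.evaluate w)
  mix-evaluate (gen i) = refl
  mix-evaluate ε       = refl
  mix-evaluate (v ∙ w) = cong₂ (λ (g , h) (g′ , h′) → g ΓG.∙ g′ , h ΓH.∙ h′) (mix-evaluate v) (mix-evaluate w)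
  mix-evaluate (w ⁻¹)  = cong (λ (g , h) → g ΓG.⁻¹ , h ΓH.⁻¹) (mix-evaluate w)

  mix-kernel⁺ : ∀ {w} → G.Kernel w → H.Kernel w → M.Kernel w
  mix-kernel⁺ {w} p q rewrite mix-evaluate w = p , q

  mix-kernel⁻ : ∀ {w} → M.Kernel w → G.Kernel w × H.Kernel w
  mix-kernel⁻ {w} p rewrite mix-evaluate w = p

collapse : ∀ {X : Set} → Word (X ⊎ X) → Word X
collapse = rename [ id , id ]′

collapse-rename : ∀ {X : Set} {ι : X → X ⊎ X} → (∀ x → [ id , id ]′ (ι x) ≡ x) →
                  ∀ w → collapse (rename ι w) ≡ w
collapse-rename e (gen x) = cong gen (e x)
collapse-rename e ε       = refl
collapse-rename e (v ∙ w) = cong₂ _∙_ (collapse-rename e v) (collapse-rename e w)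
collapse-rename e (w ⁻¹)  = cong _⁻¹ (collapse-rename e w)

module Comix {k} (G H : MarkedGroup k) where
  private
    module G = MarkedGroup G
    module H = MarkedGroup H
    module ΓG = Group G.group
    module ΓH = Group H.group
    module C = Group (G □ H)
    module HP = GroupProperties H.group
    module CP = GroupProperties (G □ H)

  infix 4 _≈□_
  _≈□_ : Rel (Word (Fin k ⊎ Fin k)) 0ℓ
  _≈□_ = ComixRelator G H ⊢_≈_

  -- The relators `identify` equate the two copies of each generator, so the left copy alone
  -- generates the comix.
  collapse-≈ : ∀ w → w ≈□ rename inj₁ (collapse w)
  collapse-≈ (gen (inj₁ i)) = reflexive
  collapse-≈ (gen (inj₂ i)) = C.trans
    (CP.inverseʳ-unique _ _ (relator (identify i))) (CP.⁻¹-involutive _)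
  collapse-≈ ε       = reflexive
  collapse-≈ (v ∙ w) = ∙-cong (collapse-≈ v) (collapse-≈ w)
  collapse-≈ (w ⁻¹)  = ⁻¹-cong (collapse-≈ w)

  kernelˡ : ∀ {w} → G.Kernel w → rename inj₁ w ≈□ ε
  kernelˡ {w} p = relator (left {w = w} p)

  -- In the comix `w` may be moved to the right copy, where it is a relator coming from `H`.
  kernelʳ : ∀ {w} → H.Kernel w → rename inj₁ w ≈□ ε
  kernelʳ {w} p = C.trans
    (C.sym (subst (λ v → rename inj₂ w ≈□ rename inj₁ v) (collapse-rename (λ _ → refl) w)
      (collapse-≈ (rename inj₂ w))))
    (relator (right {w = w} p))

  evaluate-≋⇒≈□ : ∀ u v → H.evaluate u H.≋ H.evaluate v → rename inj₁ u ≈□ rename inj₁ v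
  evaluate-≋⇒≈□ u v e = CP.x∙y⁻¹≈ε⇒x≈y _ _ (kernelʳ {u ∙ v ⁻¹} (HP.x≈y⇒x∙y⁻¹≈ε e))

  -- Congruence modulo the image in `H` of the kernel of `G`. The kernel word is kept as data, since
  -- `comix-order-≤` uses it as one coordinate of a factorisation.
  ModKernel : Rel (Word (Fin k)) 0ℓ
  ModKernel u v = ∃ λ m → G.Kernel m × H.evaluate u H.≋ H.evaluate (v ∙ m)

  private
    exact : ∀ u v → H.evaluate u H.≋ H.evaluate v → ModKernel u v
    exact u v e = ε , ΓG.refl , ΓH.trans e (ΓH.sym (ΓH.identityʳ _))

  -- The comix is the quotient of the group generated in H by the image of the kernel of G.
  ≈□⇒ModKernel : ∀ {u v} → u ≈□ v → ModKernel (collapse u) (collapse v)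
  ≈□⇒ModKernel (relator (left {w} p)) = w , p ,
    ΓH.trans (ΓH.reflexive (cong H.evaluate (collapse-rename (λ _ → refl) w))) (ΓH.sym (ΓH.identityˡ _))
  ≈□⇒ModKernel (relator (right {w} p)) = exact (collapse (rename inj₂ w)) ε
    (ΓH.trans (ΓH.reflexive (cong H.evaluate (collapse-rename (λ _ → refl) w))) p)
  ≈□⇒ModKernel (relator (identify i)) = exact (gen i ⁻¹ ∙ gen i) ε (ΓH.inverseˡ _)
  ≈□⇒ModKernel (reflexive {w}) = exact (collapse w) (collapse w) ΓH.refl
  ≈□⇒ModKernel (symmetric {v} {w} p) with ≈□⇒ModKernel p
  ... | m , m∈ , e = m ⁻¹
      , ΓG.trans (ΓG.⁻¹-cong m∈) (GroupProperties.ε⁻¹≈ε G.group)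
      , HP.x≈z//y _ _ _ (ΓH.sym e)
  ≈□⇒ModKernel (transit p q) with ≈□⇒ModKernel p | ≈□⇒ModKernel q
  ... | m , m∈ , e | n , n∈ , f = n ∙ m
      , ΓG.trans (ΓG.∙-cong n∈ m∈) (ΓG.identityʳ _)
      , ΓH.trans e (ΓH.trans (ΓH.∙-congʳ f) (ΓH.assoc _ _ _))
  ≈□⇒ModKernel (∙-cong {v} {v′} {w} {w′} p q) with ≈□⇒ModKernel p | ≈□⇒ModKernel q
  -- Normality of the kernel: moving `m` to the right past `w°` conjugates it by `w°`.
  ... | m , m∈ , e | n , n∈ , f = w° ⁻¹ ∙ (m ∙ (w° ∙ n)) , kernel , equal
    where
    v° = collapse v′
    w° = collapse w′
    kernel : G.Kernel (w° ⁻¹ ∙ (m ∙ (w° ∙ n)))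
    kernel = ΓG.trans (ΓG.∙-congˡ (ΓG.trans (ΓG.∙-cong m∈ (ΓG.trans (ΓG.∙-congˡ n∈) (ΓG.identityʳ _)))
      (ΓG.identityˡ _))) (ΓG.inverseˡ _)
    open SetoidReasoning ΓH.setoid
    equal : H.evaluate (collapse v ∙ collapse w) H.≋ H.evaluate (v° ∙ w° ∙ (w° ⁻¹ ∙ (m ∙ (w° ∙ n))))
    equal = begin
      H.evaluate (collapse v ∙ collapse w)              ≈⟨ ΓH.∙-cong e f ⟩
      H.evaluate ((v° ∙ m) ∙ (w° ∙ n))                  ≈⟨ ΓH.assoc _ _ _ ⟩
      H.evaluate (v° ∙ (m ∙ (w° ∙ n)))                  ≈⟨ ΓH.∙-congˡ (HP.\\-leftDividesˡ _ _) ⟨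
      H.evaluate (v° ∙ (w° ∙ (w° ⁻¹ ∙ (m ∙ (w° ∙ n))))) ≈⟨ ΓH.assoc _ _ _ ⟨
      H.evaluate (v° ∙ w° ∙ (w° ⁻¹ ∙ (m ∙ (w° ∙ n))))   ∎
  ≈□⇒ModKernel (⁻¹-cong {w} {w′} p) with ≈□⇒ModKernel p
  ... | m , m∈ , e = w° ∙ (m ⁻¹ ∙ w° ⁻¹)
      , ΓG.trans (ΓG.∙-congˡ (ΓG.trans (ΓG.∙-congʳ
          (ΓG.trans (ΓG.⁻¹-cong m∈) (GroupProperties.ε⁻¹≈ε G.group))) (ΓG.identityˡ _))) (ΓG.inverseʳ _)
      , ΓH.trans (ΓH.⁻¹-cong e) (ΓH.trans (HP.⁻¹-anti-homo-∙ _ _) (ΓH.sym (HP.\\-leftDividesʳ _ _)))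
    where w° = collapse w′
  ≈□⇒ModKernel (assoc u v w)  = exact (collapse (u ∙ v ∙ w)) (collapse (u ∙ (v ∙ w))) (ΓH.assoc _ _ _)
  ≈□⇒ModKernel (identityˡ w)  = exact (ε ∙ collapse w) (collapse w) (ΓH.identityˡ _)
  ≈□⇒ModKernel (identityʳ w)  = exact (collapse w ∙ ε) (collapse w) (ΓH.identityʳ _)
  ≈□⇒ModKernel (inverseˡ w)   = exact (collapse w ⁻¹ ∙ collapse w) ε (ΓH.inverseˡ _)
  ≈□⇒ModKernel (inverseʳ w)   = exact (collapse w ∙ collapse w ⁻¹) ε (ΓH.inverseʳ _)

-- Comparison of the orders of two comixes

module _ {k} (G H H′ : MarkedGroup k) where
  private
    module G = MarkedGroup G
    module H = MarkedGroup H
    module H′ = MarkedGroup H′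
    module ΓH′ = Group H′.group
    module HP = GroupProperties H.group
    module HP′ = GroupProperties H′.group
    module C = Comix G H
    module C′ = Comix G H′
    module □ = Group (G □ H)
    module □′ = Group (G □ H′)

  -- Write |H| = a |K| and |H′| = b |K′|, where K and K′ are the images of the
  -- kernel of G: K′ is a quotient of K, and the image of H embeds into that of H′ by τ.
  comix-order-≤ : (∀ {w} → G.Kernel w → H.Kernel w → H′.Kernel w) →
    (τ : Word (Fin k) → Word (Fin k)) →
    (∀ u v → H′.evaluate (τ u) H′.≋ H′.evaluate (τ v) → H.evaluate u H.≋ H.evaluate v) →
    ∀ {M} (code : Word (Fin k) → Fin M) →
    (∀ u v → code u ≡ code v → H.evaluate u H.≋ H.evaluate v) →
    ∀ {a b} → HasOrder (G □ H) a → HasOrder (G □ H′) b → a ℕ.≤ b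
  comix-order-≤ kernels τ τ-injective code code-injective {a} {b} orderₐ order-b =
    -- The base point of `X` is the empty word, and `b` is nonzero because the identity of the
    -- second comix has an index.
    cancel-finite {_~_ = _~_} f (λ {s} {t} → f-injective {s} {t})
      (code ∘ proj₁) (λ {x} {y} → code-injective (proj₁ x) (proj₁ y)) (ε , Group.refl G.group)
      {{Fin.nonZeroIndex (B.to ε)}}
    where
    module A = Inverse orderₐ
    module B = Inverse order-b

    -- With `_~_` this is `K`. Its elements are kept as words so that they can be evaluated in `H′`
    -- too.
    X : Set
    X = ∃ G.Kernel

    _~_ : Rel X 0ℓ
    _~_ = H._≋_ on (H.evaluate ∘ proj₁)

    repₐ : Fin a → Word (Fin k)
    repₐ = collapse ∘ A.from

    rep-b : Fin b → Word (Fin k)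
    rep-b = collapse ∘ B.from

    index : Word (Fin k) → Fin b
    index w = B.to (rename inj₁ w)

    -- In the comix `w` equals the representative of its class, so in `H′` they differ by a word
    -- from the kernel of `G`.
    residue : ∀ w → C′.ModKernel w (rep-b (index w))
    residue w = subst (λ v → C′.ModKernel v (rep-b (index w))) (collapse-rename (λ _ → refl) w)
      (C′.≈□⇒ModKernel (□′.sym (B.strictlyInverseʳ (rename inj₁ w))))

    join : Fin a × X → Word (Fin k)
    join (i , m , _) = repₐ i ∙ m

    split : Word (Fin k) → Fin b × X
    split w = index w , proj₁ (residue w) , proj₁ (proj₂ (residue w))

    -- A representative times an element of `K` is an element of `H`; `τ` moves it to `H′`, where it
    -- is factored again. The kernel word found there is read as an element of `K`, a lift from the
    -- quotient `K′`.
    f : Fin a × X → Fin b × X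
    f = split ∘ τ ∘ join

    join-index : ∀ s → rename inj₁ (join s) C.≈□ A.from (proj₁ s)
    join-index (i , m , m∈) = □.trans (□.∙-congˡ (C.kernelˡ {m} m∈))
      (□.trans (□.identityʳ _) (□.sym (C.collapse-≈ (A.from i))))

    join-injective : ∀ s t → H.evaluate (join s) H.≋ H.evaluate (join t) →
                     Pointwise _≡_ _~_ s t
    join-injective s@(i , m , _) t@(j , m′ , _) e = i≡j , HP.∙-cancelˡ _ _ _
      (subst (λ l → H.evaluate (repₐ i ∙ m) H.≋ H.evaluate (repₐ l ∙ m′)) (sym i≡j) e)
      where
      -- Equality in `H` passes to the comix, where the kernel factors vanish and only the
      -- representatives remain.
      i≡j : i ≡ j
      i≡j = trans (sym (A.strictlyInverseˡ i)) (trans (A.to-cong (□.trans (□.sym (join-index s))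
        (□.trans (C.evaluate-≋⇒≈□ (join s) (join t) e) (join-index t)))) (A.strictlyInverseˡ j))

    -- The quotient map from `K` to `K′` is well defined, as `u ∙ v ⁻¹` lies in the kernels of both
    -- `G` and `H`.
    kernel-≋ : ∀ x y → x ~ y → H′.evaluate (proj₁ x) H′.≋ H′.evaluate (proj₁ y)
    kernel-≋ (u , u∈) (v , v∈) e = HP′.x∙y⁻¹≈ε⇒x≈y _ _ (kernels {u ∙ v ⁻¹}
      (GroupProperties.x≈y⇒x∙y⁻¹≈ε G.group (Group.trans G.group u∈ (Group.sym G.group v∈)))
      (HP.x≈y⇒x∙y⁻¹≈ε e))

    split-injective : ∀ u v → Pointwise _≡_ _~_ (split u) (split v) →
                      H′.evaluate u H′.≋ H′.evaluate v
    split-injective u v (i , e) with residue u | residue v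
    ... | m , m∈ , p | m′ , m′∈ , q = ΓH′.trans p (ΓH′.trans
      (ΓH′.∙-cong (ΓH′.reflexive (cong (H′.evaluate ∘ rep-b) i)) (kernel-≋ (m , m∈) (m′ , m′∈) e)) (ΓH′.sym q))

    f-injective : Injective (Pointwise _≡_ _~_) (Pointwise _≡_ _~_) f
    f-injective {s} {t} e = join-injective s t
      (τ-injective (join s) (join t) (split-injective (τ (join s)) (τ (join t)) e))

-- Flags and rotations

module Flags {n} (R : RankedPoset n) (isPolytope : RankedPoset.IsPolytope R) where
  open RankedPoset R
  open IsPolytope isPolytope
  open FlagExchange isPolytope using (between)

  flagSetoid : Setoid 0ℓ 0ℓ
  flagSetoid = record
    { Carrier       = Flag
    ; _≈_           = _≈ᶠ_
    ; isEquivalence = record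
      { refl  = λ _ → refl
      ; sym   = λ e i → sym (e i)
      ; trans = λ d e i → trans (d i) (e i)
      }
    }

  private
    at-1≢at : (j : Fin n) → at-1 j ≢ at j
    at-1≢at j e = ℕ.1+n≢n (sym (trans (sym (Fin.toℕ-inject₁ (inject₁ j))) (cong toℕ e)))

    at+1≢at : (j : Fin n) → at+1 j ≢ at j
    at+1≢at j e = ℕ.1+n≢n (trans (cong toℕ (Fin.suc-injective e)) (Fin.toℕ-inject₁ j))

  -- This locality is why exchanges at non-neighbouring ranks commute.
  exchanged-face : ∀ j Φ Φ′ Ψ Ψ′ → DifferAt (at j) Φ Φ′ → DifferAt (at j) Ψ Ψ′ →
    face Φ (at-1 j) ≡ face Ψ (at-1 j) → face Φ (at j) ≡ face Ψ (at j) →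
    face Φ (at+1 j) ≡ face Ψ (at+1 j) → face Φ′ (at j) ≡ face Ψ′ (at j)
  exchanged-face j Φ Φ′ Ψ Ψ′ (Φ≢Φ′ , Φ≡Φ′) (Ψ≢Ψ′ , Ψ≡Ψ′) lo mid hi
    with diamond j (<-trans (proj₁ (between Φ j)) (proj₂ (between Φ j)))
           (Flag.rank-face Φ _) (Flag.rank-face Φ _)
  ... | x , y , _ , _ , _ , only =
    -- Both new faces lie in a two-element set and differ from the same old element of it, so they
    -- coincide.
    pick (only _ (Flag.rank-face Φ _ , between Φ j))
         (only _ (in-diamond Φ′ (Φ≡Φ′ _ (at-1≢at j)) (Φ≡Φ′ _ (at+1≢at j))))
         (only _ (in-diamond Ψ′ (trans lo (Ψ≡Ψ′ _ (at-1≢at j))) (trans hi (Ψ≡Ψ′ _ (at+1≢at j)))))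
    where
    in-diamond : ∀ Λ → face Φ (at-1 j) ≡ face Λ (at-1 j) → face Φ (at+1 j) ≡ face Λ (at+1 j) →
      rank (face Λ (at j)) ≡ at j × face Φ (at-1 j) < face Λ (at j) × face Λ (at j) < face Φ (at+1 j)
    in-diamond Λ l h = Flag.rank-face Λ _
      , subst (_< face Λ (at j)) (sym l) (proj₁ (between Λ j))
      , subst (face Λ (at j) <_) (sym h) (proj₂ (between Λ j))
    pick : face Φ (at j) ≡ x ⊎ face Φ (at j) ≡ y → face Φ′ (at j) ≡ x ⊎ face Φ′ (at j) ≡ y →
           face Ψ′ (at j) ≡ x ⊎ face Ψ′ (at j) ≡ y → face Φ′ (at j) ≡ face Ψ′ (at j)
    pick _        (inj₁ p) (inj₁ q) = trans p (sym q)
    pick _        (inj₂ p) (inj₂ q) = trans p (sym q)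
    pick (inj₁ r) (inj₁ p) (inj₂ _) = contradiction (trans r (sym p)) Φ≢Φ′
    pick (inj₁ r) (inj₂ _) (inj₁ q) = contradiction (trans (sym mid) (trans r (sym q))) Ψ≢Ψ′
    pick (inj₂ r) (inj₁ _) (inj₂ q) = contradiction (trans (sym mid) (trans r (sym q))) Ψ≢Ψ′
    pick (inj₂ r) (inj₂ p) (inj₁ _) = contradiction (trans r (sym p)) Φ≢Φ′

  differAt-unique : ∀ j Φ Φ′ Ψ Ψ′ → Φ ≈ᶠ Ψ → DifferAt (at j) Φ Φ′ → DifferAt (at j) Ψ Ψ′ → Φ′ ≈ᶠ Ψ′
  differAt-unique j Φ Φ′ Ψ Ψ′ e d d′ i with i Fin.≟ at j
  ... | yes refl = exchanged-face j Φ Φ′ Ψ Ψ′ d d′ (e _) (e _) (e _)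
  ... | no  i≢   = trans (sym (proj₂ d i i≢)) (trans (e i) (proj₂ d′ i i≢))

  differAt-sym : ∀ {i} Φ Ψ → DifferAt i Φ Ψ → DifferAt i Ψ Φ
  differAt-sym _ _ (neq , same) = neq ∘ sym , λ j j≢ → sym (same j j≢)

  to-injective : ∀ g {F G} → to g F ≡ to g G → F ≡ G
  to-injective g e = trans (sym (Automorphism.strictlyInverseʳ g _))
    (trans (cong (from g) e) (Automorphism.strictlyInverseʳ g _))

  ◃-cong : ∀ {Φ Ψ} g → Φ ≈ᶠ Ψ → Φ ◃ g ≈ᶠ Ψ ◃ g
  ◃-cong g e i = cong (to g) (e i)

  ◃-differ : ∀ {i} Φ Ψ g → DifferAt i Φ Ψ → DifferAt i (Φ ◃ g) (Ψ ◃ g)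
  ◃-differ _ _ g (neq , same) = neq ∘ to-injective g , λ j j≢ → cong (to g) (same j j≢)

  -- The flags are pinned down by `DifferAt` alone, so that the notion passes to the dual without
  -- comparing two constructions of the exchange.
  record Rotates (Φ : Flag) (g : Automorphism) (i j : Fin n) : Set where
    constructor rotates
    field
      middle target : Flag
      first         : DifferAt (at i) Φ middle
      second        : DifferAt (at j) middle target
      image         : Φ ◃ g ≈ᶠ target

  -- Abstracted to its defining property: comparing flags by unfolding the
  -- construction of the exchange is prohibitively slow.
  module Exchange (exchange : Flag → Fin n → Flag)
                  (exchange-differ : ∀ Φ j → DifferAt (at j) Φ (exchange Φ j)) where

    infixl 8 _^_
    _^_ : Flag → Fin n → Flag
    _^_ = exchange

    ^-differ : ∀ Φ j → DifferAt (at j) Φ (Φ ^ j)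
    ^-differ = exchange-differ

    ^-unique : ∀ j Φ Ψ → DifferAt (at j) Φ Ψ → Φ ^ j ≈ᶠ Ψ
    ^-unique j Φ Ψ = differAt-unique j Φ (Φ ^ j) Φ Ψ (λ _ → refl) (^-differ Φ j)

    ^-cong : ∀ {Φ Ψ} j → Φ ≈ᶠ Ψ → Φ ^ j ≈ᶠ Ψ ^ j
    ^-cong {Φ} {Ψ} j e = differAt-unique j Φ (Φ ^ j) Ψ (Ψ ^ j) e (^-differ Φ j) (^-differ Ψ j)

    ^-involutive : ∀ Φ j → Φ ^ j ^ j ≈ᶠ Φ
    ^-involutive Φ j = ^-unique j (Φ ^ j) Φ (differAt-sym Φ (Φ ^ j) (^-differ Φ j))

    -- By uniqueness it suffices that `Φ ^ j` and `Φ ^ i ^ j` differ exactly at rank `i`. At rank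
    -- `j` they agree by `exchanged-face`: the gap in rank gives `Φ` and `Φ ^ i` the same faces of
    -- ranks j - 1, j and j + 1.
    ^-comm : ∀ {i j} → suc (toℕ i) ℕ.< toℕ j → ∀ Φ → Φ ^ i ^ j ≈ᶠ Φ ^ j ^ i
    ^-comm {i} {j} i+1<j Φ l = sym (^-unique i (Φ ^ j) (Φ ^ i ^ j) (differ , same) l)
      where
      i-at : toℕ (at i) ≡ suc (toℕ i)
      i-at = cong suc (Fin.toℕ-inject₁ i)
      j-at-1 : toℕ (at-1 j) ≡ toℕ j
      j-at-1 = trans (Fin.toℕ-inject₁ (inject₁ j)) (Fin.toℕ-inject₁ j)
      below : ∀ {l} → toℕ j ℕ.≤ toℕ l → l ≢ at i
      below j≤l refl = ℕ.<⇒≱ i+1<j (subst (toℕ j ℕ.≤_) i-at j≤l)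
      at-j≢at-i : at j ≢ at i
      at-j≢at-i = below (subst (toℕ j ℕ.≤_) (sym (cong suc (Fin.toℕ-inject₁ j))) (ℕ.n≤1+n _))
      differ : face (Φ ^ j) (at i) ≢ face (Φ ^ i ^ j) (at i)
      differ e = proj₁ (^-differ Φ i) (trans (proj₂ (^-differ Φ j) _ (at-j≢at-i ∘ sym))
        (trans e (sym (proj₂ (^-differ (Φ ^ i) j) _ (at-j≢at-i ∘ sym)))))
      same : ∀ l → l ≢ at i → face (Φ ^ j) l ≡ face (Φ ^ i ^ j) l
      same l l≢ with l Fin.≟ at j
      ... | no  l≢j  = trans (sym (proj₂ (^-differ Φ j) l l≢j))
        (trans (proj₂ (^-differ Φ i) l l≢) (proj₂ (^-differ (Φ ^ i) j) l l≢j))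
      ... | yes refl = exchanged-face j Φ (Φ ^ j) (Φ ^ i) (Φ ^ i ^ j) (^-differ Φ j) (^-differ (Φ ^ i) j)
        (proj₂ (^-differ Φ i) _ (below (ℕ.≤-reflexive (sym j-at-1))))
        (proj₂ (^-differ Φ i) _ at-j≢at-i)
        (proj₂ (^-differ Φ i) _ (below (ℕ.m≤n+m _ 2)))

    ◃-^ : ∀ Φ g j → (Φ ^ j) ◃ g ≈ᶠ (Φ ◃ g) ^ j
    ◃-^ Φ g j i = sym (^-unique j (Φ ◃ g) ((Φ ^ j) ◃ g) (◃-differ Φ (Φ ^ j) g (^-differ Φ j)) i)

    open SetoidReasoning flagSetoid

    ◃-^² : ∀ Φ g i j → (Φ ^ i ^ j) ◃ g ≈ᶠ (Φ ◃ g) ^ i ^ j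
    ◃-^² Φ g i j = begin
      (Φ ^ i ^ j) ◃ g   ≈⟨ ◃-^ (Φ ^ i) g j ⟩
      ((Φ ^ i) ◃ g) ^ j ≈⟨ ^-cong j (◃-^ Φ g i) ⟩
      (Φ ◃ g) ^ i ^ j   ∎

    -- Automorphisms commute with exchanges, so in a product the exchanges of the left factor come
    -- after those of the right factor.
    ◃-rotate : ∀ Φ g h i j → Φ ◃ g ≈ᶠ Φ ^ i ^ j → Φ ◃ g ◃ h ≈ᶠ (Φ ◃ h) ^ i ^ j
    ◃-rotate Φ g h i j e = begin
      Φ ◃ g ◃ h       ≈⟨ ◃-cong {Φ ◃ g} {Φ ^ i ^ j} h e ⟩
      (Φ ^ i ^ j) ◃ h ≈⟨ ◃-^² Φ h i j ⟩
      (Φ ◃ h) ^ i ^ j ∎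

    rotates⁺ : ∀ {Φ Ψ g i j} → Ψ ≈ᶠ Φ → Ψ ◃ g ≈ᶠ Φ ^ i ^ j → Rotates Ψ g i j
    rotates⁺ {Φ} {Ψ} {g} {i} {j} Ψ≈Φ e = rotates (Ψ ^ i) (Ψ ^ i ^ j) (^-differ Ψ i) (^-differ (Ψ ^ i) j) (begin
      Ψ ◃ g     ≈⟨ e ⟩
      Φ ^ i ^ j ≈⟨ ^-cong j (^-cong i Ψ≈Φ) ⟨
      Ψ ^ i ^ j ∎)

    rotates⁻ : ∀ {Φ g i j} → Rotates Φ g i j → Φ ◃ g ≈ᶠ Φ ^ i ^ j
    rotates⁻ {Φ} {g} {i} {j} (rotates Ψ₁ Ψ₂ d₁ d₂ e) = begin
      Φ ◃ g     ≈⟨ e ⟩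
      Ψ₂        ≈⟨ ^-unique j Ψ₁ Ψ₂ d₂ ⟨
      Ψ₁ ^ j    ≈⟨ ^-cong j (^-unique i Φ Ψ₁ d₁) ⟨
      Φ ^ i ^ j ∎

    private
      inverse-exchange : ∀ Φ g i j → Rotates Φ g i j → Φ ◃ inverse g ≈ᶠ Φ ^ j ^ i
      inverse-exchange Φ g i j r = begin
        Φ ◃ inverse g                   ≈⟨ ^-involutive (Φ ◃ inverse g) i ⟨
        (Φ ◃ inverse g) ^ i ^ i         ≈⟨ ^-cong i (^-involutive ((Φ ◃ inverse g) ^ i) j) ⟨
        (Φ ◃ inverse g) ^ i ^ j ^ j ^ i ≈⟨ ^-cong i (^-cong j returns) ⟩
        Φ ^ j ^ i                       ∎
        where
        returns : (Φ ◃ inverse g) ^ i ^ j ≈ᶠ Φ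
        returns = begin
          (Φ ◃ inverse g) ^ i ^ j ≈⟨ ◃-^² Φ (inverse g) i j ⟨
          (Φ ^ i ^ j) ◃ inverse g ≈⟨ ◃-cong {Φ ◃ g} {Φ ^ i ^ j} (inverse g) (rotates⁻ r) ⟨
          Φ ◃ g ◃ inverse g       ≈⟨ (λ l → Automorphism.strictlyInverseʳ g (face Φ l)) ⟩
          Φ                       ∎

      mirrored : ∀ {Φ Φ′ g i j l} → DifferAt (at l) Φ Φ′ → (Φ ◃ g) ^ l ≈ᶠ Φ ^ l ^ i ^ j → Rotates Φ′ g i j
      mirrored {Φ} {Φ′} {g} {i} {j} {l} d e = rotates⁺ {Φ ^ l} {Φ′} {g} Φ′≈ (begin
        Φ′ ◃ g            ≈⟨ ◃-cong {Φ′} {Φ ^ l} g Φ′≈ ⟩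
        (Φ ^ l) ◃ g       ≈⟨ ◃-^ Φ g l ⟩
        (Φ ◃ g) ^ l       ≈⟨ e ⟩
        Φ ^ l ^ i ^ j     ∎)
        where
        Φ′≈ : Φ′ ≈ᶠ Φ ^ l
        Φ′≈ m = sym (^-unique l Φ Φ′ d m)

    rotates-inverse : ∀ Φ g i j → Rotates Φ g i j → Rotates Φ (inverse g) j i
    rotates-inverse Φ g i j r = rotates⁺ {Φ} {Φ} {inverse g} (λ _ → refl) (inverse-exchange Φ g i j r)

    -- The rule σ₁ ↦ σ₁⁻¹ of `bar`, at i = 1 and j = 0: exchanging rank 0 in Φ^{0,1} gives the flag
    -- that σ₁ of the mirror image must reach from Φ^0.
    mirror-inverse : ∀ Φ Φ′ g i j → DifferAt (at j) Φ Φ′ → Rotates Φ g i j → Rotates Φ′ (inverse g) i j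
    mirror-inverse Φ Φ′ g i j d r = mirrored {Φ} {Φ′} {inverse g} d (^-cong j (inverse-exchange Φ g i j r))

    -- The rule σ₂ ↦ σ₁²σ₂, at i = 1, j = 0 and l = 2: repeated exchanges cancel, and ranks 0 and 2
    -- commute.
    mirror-product : ∀ Φ Φ′ g h i j l → DifferAt (at j) Φ Φ′ → suc (toℕ j) ℕ.< toℕ l →
      Rotates Φ g i j → Rotates Φ h l i → Rotates Φ′ (compose (compose g g) h) l i
    mirror-product Φ Φ′ g h i j l d j+1<l r s = mirrored {Φ} {Φ′} {compose (compose g g) h} d (begin
      (Φ ◃ g ◃ compose g h) ^ j ≈⟨ ^-cong j (◃-rotate Φ g (compose g h) i j (rotates⁻ r)) ⟩
      (Φ ◃ g ◃ h) ^ i ^ j ^ j   ≈⟨ ^-involutive ((Φ ◃ g ◃ h) ^ i) j ⟩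
      (Φ ◃ g ◃ h) ^ i           ≈⟨ ^-cong i (◃-rotate Φ g h i j (rotates⁻ r)) ⟩
      (Φ ◃ h) ^ i ^ j ^ i       ≈⟨ ^-cong i (^-cong j (^-cong i (rotates⁻ s))) ⟩
      Φ ^ l ^ i ^ i ^ j ^ i     ≈⟨ ^-cong i (^-cong j (^-involutive (Φ ^ l) i)) ⟩
      Φ ^ l ^ j ^ i             ≈⟨ ^-cong i (^-comm j+1<l Φ) ⟨
      Φ ^ j ^ l ^ i             ∎)

    -- The rule fixing σⱼ for j ≥ 3: both of its ranks are at least 2, so their exchanges commute
    -- with that of rank 0.
    mirror-fixed : ∀ Φ Φ′ g i j l → DifferAt (at l) Φ Φ′ → suc (toℕ l) ℕ.< toℕ i → suc (toℕ l) ℕ.< toℕ j →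
      Rotates Φ g i j → Rotates Φ′ g i j
    mirror-fixed Φ Φ′ g i j l d l+1<i l+1<j r = mirrored {Φ} {Φ′} {g} d (begin
      (Φ ◃ g) ^ l   ≈⟨ ^-cong l (rotates⁻ r) ⟩
      Φ ^ i ^ j ^ l ≈⟨ ^-comm l+1<j (Φ ^ i) ⟨
      Φ ^ i ^ l ^ j ≈⟨ ^-cong j (^-comm l+1<i Φ) ⟨
      Φ ^ l ^ i ^ j ∎)

  face-zero : ∀ Φ → face Φ zero ≡ least
  face-zero Φ with least-≤ (face Φ zero)
  ... | inj₂ e = sym e
  ... | inj₁ l = contradiction (subst (rank least Fin.<_) (Flag.rank-face Φ zero) (rank-mono l)) λ ()

  face-top : ∀ Φ → face Φ (fromℕ (suc n)) ≡ greatest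
  face-top Φ with ≤-greatest (face Φ (fromℕ (suc n)))
  ... | inj₂ e = e
  ... | inj₁ l = contradiction (rank-mono l)
    (Fin.<-irrefl (trans (Flag.rank-face Φ _) (sym rank-greatest)))

  adjacent-proper : ∀ Φ Ψ → Adjacent Φ Ψ → ∃ λ j → DifferAt (at j) Φ Ψ
  adjacent-proper Φ Ψ (zero , neq , _) = contradiction (trans (face-zero Φ) (sym (face-zero Ψ))) neq
  adjacent-proper Φ Ψ (suc i , d) with view i
  ... | ‵fromℕ     = contradiction (trans (face-top Φ) (sym (face-top Ψ))) (proj₁ d)
  ... | ‵inject₁ j = j , d

  -- Agreement spreads to an adjacent flag, since its image is the only flag differing from the
  -- common image at the given rank.
  agree-path : ∀ g h {Q Φ Ψ} → Path Q Φ Ψ → Φ ◃ g ≈ᶠ Φ ◃ h → Ψ ◃ g ≈ᶠ Ψ ◃ h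
  agree-path g h (done e) agree i =
    trans (cong (to g) (sym (e i))) (trans (agree i) (cong (to h) (e i)))
  agree-path g h (step {Φ} {Λ} adj _ path) agree with adjacent-proper Φ Λ adj
  ... | j , d = agree-path g h path (differAt-unique j (Φ ◃ g) (Λ ◃ g) (Φ ◃ h) (Λ ◃ h) agree
    (◃-differ Φ Λ g d) (◃-differ Φ Λ h d))

  Ascending : ∀ {k} → (Fin k → Face) → Set
  Ascending f = ∀ {i j} → i Fin.< j → f i < f j

  ∷-ascending : ∀ {k G} {f : Fin k → Face} → (∀ i → G < f i) → Ascending f → Ascending (G ∷ f)
  ∷-ascending lt asc {zero}  {suc j} _         = lt j
  ∷-ascending lt asc {suc i} {suc j} (s≤s i<j) = asc i<j

  ascending-length : ∀ {k} {f : Fin k → Face} → Ascending f → k ℕ.≤ 2 + n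
  ascending-length {zero}  asc = z≤n
  ascending-length {suc k} {f} asc = ℕ.≤-<-trans
    (subst (ℕ._≤ toℕ (rank (f (fromℕ k)))) (Fin.toℕ-fromℕ k)
      (ascending⇒inflationary (rank ∘ f) (rank-mono ∘ asc) (fromℕ k)))
    (Fin.toℕ<n (rank (f (fromℕ k))))

  -- The last component, on lower bounds, is what allows `f zero` to be put in front of the result
  -- of the recursive call.
  insert : ∀ {k} G (f : Fin k → Face) → Ascending f →
           (∀ i → Comparable G (f i)) → (∀ i → f i ≢ G) →
           Σ (Fin (suc k) → Face) λ h → Ascending h × (∀ i → ∃ λ j → h j ≡ f i)
             × (∀ {F} → F < G → (∀ i → F < f i) → ∀ i → F < h i)
  insert {zero} G f asc cmp neq =
    (λ _ → G) , (λ { {zero} {zero} () }) , (λ ()) , λ F<G _ _ → F<G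
  insert {suc k} G f asc cmp neq with cmp zero
  ... | inj₁ (inj₂ e) = contradiction (sym e) (neq zero)
  ... | inj₂ (inj₂ e) = contradiction e (neq zero)
  ... | inj₁ (inj₁ G<f₀) = G ∷ f , ∷-ascending below asc , (λ i → suc i , refl)
      , λ { F<G F<f zero → F<G ; F<G F<f (suc i) → F<f i }
    where
    below : ∀ i → G < f i
    below zero    = G<f₀
    below (suc i) = <-trans G<f₀ (asc (s≤s z≤n))
  ... | inj₂ (inj₁ f₀<G) with insert G (tail f) (asc ∘ s≤s) (cmp ∘ suc) (neq ∘ suc)
  ...   | h , h-asc , h-contains , h-above =
        f zero ∷ h
      , ∷-ascending (h-above f₀<G (λ _ → asc (s≤s z≤n))) h-asc
      , (λ { zero → zero , refl ; (suc i) → let j , e = h-contains i in suc j , e })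
      , λ { F<G F<f zero → F<f zero ; F<G F<f (suc i) → h-above F<G (F<f ∘ suc) i }

  chain⇒flag : ∀ {k F} (f : Fin k → Face) → IsMaximalChain f → (∃ λ i → f i ≡ F) → ∃ λ Φ → F ∈ Φ
  chain⇒flag f chain F∈f with refl ← flag-length f chain =
    record { face = f ; isMaximalChain = chain } , F∈f

  module _ (_≟_ : DecidableEquality Face) where

    private
      -- If no flag contains F, every chain through F can be lengthened.
      lengthen : ∀ F → ¬ (∃ λ Φ → F ∈ Φ) → ∀ fuel {k} (f : Fin k → Face) → Ascending f →
                 (∃ λ i → f i ≡ F) → 2 + n ℕ.< k + fuel → ⊥
      lengthen F none zero {k} f asc _ long = ℕ.<⇒≱ long
        (subst (ℕ._≤ 2 + n) (sym (ℕ.+-identityʳ k)) (ascending-length asc))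
      lengthen F none (suc fuel) {k} f asc (i₀ , e₀) long
        = none (chain⇒flag f (record { ascending = asc ; maximal = maximal }) (i₀ , e₀))
        where
        maximal : ∀ G → (∀ i → Comparable G (f i)) → ∃ λ i → f i ≡ G
        maximal G cmp with Fin.any? (λ i → f i ≟ G)
        ... | yes found = found
        ... | no  none′ with insert G f asc cmp (λ i e → none′ (i , e))
        ...   | h , h-asc , h-contains , _ = contradiction
          (let j , e = h-contains i₀ in j , trans e e₀)
          (λ F∈h → lengthen F none fuel h h-asc F∈h (subst (2 + n ℕ.<_) (ℕ.+-suc k fuel) long))

    -- The order is not assumed decidable, so a flag through `F` is not constructed. The double
    -- negation suffices for `◃-free`, where equality of faces is decidable.
    in-some-flag : ∀ F → ¬ ¬ (∃ λ Φ → F ∈ Φ)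
    -- One face plus the fuel `2 + n` exceeds the greatest possible length of a chain, and
    -- lengthening preserves this sum.
    in-some-flag F none = lengthen F none (2 + n) (λ (_ : Fin 1) → F)
      (λ { {zero} {zero} () }) (zero , refl) ℕ.≤-refl

    ◃-free : ∀ Φ g h → Φ ◃ g ≈ᶠ Φ ◃ h → ∀ F → to g F ≡ to h F
    ◃-free Φ g h agree F = decidable-stable (to g F ≟ to h F) λ neq →
      in-some-flag F λ (Ψ , i , e) → neq (subst (λ G → to g G ≡ to h G) e
        (agree-path g h (strongly-flag-connected Φ Ψ) agree i))

    -- The generators `σ` come out of an existence proof; this identifies them by the exchanges they
    -- perform.
    rotates-unique : ∀ Φ Ψ g h i j → Φ ≈ᶠ Ψ → Rotates Φ g i j → Rotates Ψ h i j → ∀ F → to g F ≡ to h F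
    rotates-unique Φ Ψ g h i j e (rotates Φ₁ Φ₂ d₁ d₂ p) (rotates Ψ₁ Ψ₂ d₁′ d₂′ q) = ◃-free Φ g h λ l →
      trans (p l) (trans (differAt-unique j Φ₁ Φ₂ Ψ₁ Ψ₂ (differAt-unique i Φ Φ₁ Ψ Ψ₁ e d₁ d₁′) d₂ d₂′ l)
        (trans (sym (q l)) (cong (to h) (sym (e l)))))

-- Duals and mirror images

opposite-at : ∀ {n} (j : Fin n) → opposite (at j) ≡ at (opposite j)
opposite-at j = cong inject₁ (opposite-inject₁ j)

opposite-upper : ∀ {n} (i : Fin (n ∸ 1)) → opposite (upper {n} i) ≡ lower (opposite i)
opposite-upper {suc n} i = refl

opposite-lower : ∀ {n} (i : Fin (n ∸ 1)) → opposite (lower {n} i) ≡ upper (opposite i)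
opposite-lower {suc n} i = opposite-inject₁ i

module _ {n} (R : RankedPoset n) where
  private
    module R = RankedPoset R
    module D = RankedPoset (dualPoset R)

  differAt-fromDual : ∀ j Φ Ψ → D.DifferAt (at j) Φ Ψ →
                      R.DifferAt (at (opposite j)) (fromDual R Φ) (fromDual R Ψ)
  differAt-fromDual j Φ Ψ (neq , same) =
      subst (λ i → D.face Φ i ≢ D.face Ψ i) (sym back) neq
    , λ i i≢ → same (opposite i) λ e → i≢ (trans (sym (Fin.opposite-involutive i))
        (trans (cong opposite e) (opposite-at j)))
    where
    back : opposite (at (opposite j)) ≡ at j
    back = trans (opposite-at (opposite j)) (cong at (Fin.opposite-involutive j))

  automorphismFromDual-homo : IsGroupHomomorphism (Group.rawGroup D.Γ) (Group.rawGroup R.Γ)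
                                                  (automorphismFromDual R)
  automorphismFromDual-homo = record
    { isMonoidHomomorphism = record
      { isMagmaHomomorphism = record
        { isRelHomomorphism = record { cong = id }
        ; homo              = λ _ _ _ → refl
        }
      ; ε-homo = λ _ → refl
      }
    ; ⁻¹-homo = λ _ _ → refl
    }

module _ {n} (R : RankedPoset n) (isPolytope : RankedPoset.IsPolytope R) where
  private
    module FR = Flags R isPolytope
    module FD = Flags (dualPoset R) (dualIsPolytope R isPolytope)

  rotates-fromDual : ∀ Φ g i j → FD.Rotates Φ g i j →
    FR.Rotates (fromDual R Φ) (automorphismFromDual R g) (opposite i) (opposite j)
  rotates-fromDual Φ g i j (FD.rotates Ψ₁ Ψ₂ d₁ d₂ e) = FR.rotates (fromDual R Ψ₁) (fromDual R Ψ₂)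
    (differAt-fromDual R i Φ Ψ₁ d₁) (differAt-fromDual R j Ψ₁ Ψ₂ d₂) (e ∘ opposite)

module _ {n} (P : ChiralPolytope n) where
  open ChiralPolytope P

  σ-rotates : ∀ i → Flags.Rotates rankedPoset isPolytope base (σ P i) (upper i) (lower i)
  σ-rotates i = Flags.rotates (base ^ upper i) (base ^ upper i ^ lower i)
    (^-differ base (upper i)) (^-differ (base ^ upper i) (lower i)) (proj₂ (σ-exists P i))

-- Applying `bar` twice sends σ₂ to σ₁⁻²σ₁²σ₂. Hence words can also be translated from `P` to its
-- mirror image.
bar-involutive : ∀ {k} (G : MarkedGroup k) i →
  MarkedGroup._≋_ G (MarkedGroup.generator G i) (MarkedGroup.evaluate G (bar (barGenerator i)))
bar-involutive G zero          = Group.sym group (GroupProperties.⁻¹-involutive group _)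
  where open MarkedGroup G
bar-involutive G (suc zero)    = begin
  σ₂                                                   ≈⟨ \\-leftDividesʳ (σ₁ ΓG.∙ σ₁) σ₂ ⟨
  (σ₁ ΓG.∙ σ₁) ΓG.⁻¹ ΓG.∙ ((σ₁ ΓG.∙ σ₁) ΓG.∙ σ₂)       ≈⟨ ΓG.∙-congʳ (⁻¹-anti-homo-∙ σ₁ σ₁) ⟩
  (σ₁ ΓG.⁻¹ ΓG.∙ σ₁ ΓG.⁻¹) ΓG.∙ ((σ₁ ΓG.∙ σ₁) ΓG.∙ σ₂) ∎
  where
  open MarkedGroup G
  module ΓG = Group group
  open GroupProperties group using (\\-leftDividesʳ; ⁻¹-anti-homo-∙)
  open SetoidReasoning ΓG.setoid
  σ₁ = generator zero
  σ₂ = generator (suc zero)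
bar-involutive G (suc (suc i)) = Group.refl (MarkedGroup.group G)

-- The automorphism δ of `W⁺`: index i stands for the generator with number i + 1, so `opposite`
-- takes number i to n - i.
deltaGenerator : ∀ {k} → Fin k → Word (Fin k)
deltaGenerator i = gen (opposite i) ⁻¹

delta : ∀ {k} → Word (Fin k) → Word (Fin k)
delta = substitute deltaGenerator

module _ {n} (P : ChiralPolytope n) (_≟_ : DecidableEquality (ChiralPolytope.Face P)) where
  private
    module P = ChiralPolytope P
    module D = ChiralPolytope (P ᵟ)
    module Fl = Flags P.rankedPoset P.isPolytope
    module E = Fl.Exchange P._^_ P.^-differ
    module ΓP = Group P.Γ
    module Γ⁺P = MarkedGroup (Γ⁺ P)
    module Γ⁺D = MarkedGroup (Γ⁺ (P ᵟ))
    fromD = automorphismFromDual P.rankedPoset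

  -- Reversing ranks turns `upper` then `lower` into `lower` then `upper` at the opposite index,
  -- which is the effect of an inverse rotation.
  σ-dual : ∀ i → fromD (σ (P ᵟ) i) ΓP.≈ σ P (opposite i) ΓP.⁻¹
  σ-dual i = Fl.rotates-unique _≟_ (fromDual P.rankedPoset D.base) P.base _ _
    (lower (opposite i)) (upper (opposite i))
    (λ l → cong (P.face P.base) (Fin.opposite-involutive l))
    (subst₂ (Fl.Rotates _ _) (opposite-upper i) (opposite-lower i)
      (rotates-fromDual P.rankedPoset P.isPolytope D.base (σ (P ᵟ) i) (upper i) (lower i) (σ-rotates (P ᵟ) i)))
    (E.rotates-inverse P.base (σ P (opposite i)) (upper (opposite i)) (lower (opposite i))
      (σ-rotates P (opposite i)))

  evaluate-dual : ∀ w → fromD (Γ⁺D.evaluate w) ΓP.≈ Γ⁺P.evaluate (delta w)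
  evaluate-dual = evaluate-substitute (Γ⁺ P) (Γ⁺ (P ᵟ))
    (automorphismFromDual-homo P.rankedPoset) deltaGenerator σ-dual

σ-mirror : ∀ {n} (P : ChiralPolytope n) → DecidableEquality (ChiralPolytope.Face P) →
           ∀ i → Group._≈_ (ChiralPolytope.Γ P) (σ (mirror P) i)
                   (MarkedGroup.evaluate (Γ⁺ P) (barGenerator i))
σ-mirror {suc n} P _≟_ = λ where
    zero          → unique zero _ (E.mirror-inverse base Φ⁰ (σ P zero) _ _ adjacent (σ-rotates P zero))
    (suc zero)    → unique (suc zero) _ (E.mirror-product base Φ⁰ (σ P zero) (σ P (suc zero)) _ _ _
      adjacent (s≤s (s≤s z≤n)) (σ-rotates P zero) (σ-rotates P (suc zero)))
    (suc (suc i)) → unique (suc (suc i)) _ (E.mirror-fixed base Φ⁰ (σ P (suc (suc i))) _ _ zero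
      adjacent (s≤s (s≤s z≤n)) (s≤s (s≤s z≤n)) (σ-rotates P (suc (suc i))))
  where
  open ChiralPolytope P
  module Fl = Flags rankedPoset isPolytope
  module E = Fl.Exchange _^_ ^-differ
  Φ⁰ : Flag
  Φ⁰ = mirrorBase P
  adjacent : DifferAt (at zero) base Φ⁰
  adjacent = ^-differ base zero
  unique : ∀ i g → Fl.Rotates Φ⁰ g (upper i) (lower i) → ∀ F → to (σ (mirror P) i) F ≡ to g F
  unique i g = Fl.rotates-unique _≟_ Φ⁰ Φ⁰ (σ (mirror P) i) g (upper i) (lower i) (λ _ → refl)
    (σ-rotates (mirror P) i)

module _ {n} (P : ChiralPolytope n) (_≟_ : DecidableEquality (ChiralPolytope.Face P)) where
  private
    module P = ChiralPolytope P
    module ΓP = Group P.Γ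
    module Γ⁺P = MarkedGroup (Γ⁺ P)
    module Γ⁺M = MarkedGroup (Γ⁺ (mirror P))
    identity-homo = Identity.isGroupHomomorphism ΓP.rawGroup (λ {g} → ΓP.refl {g})

  evaluate-mirror : ∀ w → Γ⁺M.evaluate w ΓP.≈ Γ⁺P.evaluate (bar w)
  evaluate-mirror = evaluate-substitute (Γ⁺ P) (Γ⁺ (mirror P)) identity-homo barGenerator (σ-mirror P _≟_)

  σ-unmirror : ∀ i → σ P i ΓP.≈ Γ⁺M.evaluate (barGenerator i)
  σ-unmirror i = ΓP.trans {σ P i} {Γ⁺P.evaluate (bar (barGenerator i))} {Γ⁺M.evaluate (barGenerator i)}
    (bar-involutive (Γ⁺ P) i) (ΓP.sym {Γ⁺M.evaluate (barGenerator i)} {Γ⁺P.evaluate (bar (barGenerator i))}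
      (evaluate-mirror (barGenerator i)))

  evaluate-unmirror : ∀ w → Γ⁺P.evaluate w ΓP.≈ Γ⁺M.evaluate (bar w)
  evaluate-unmirror = evaluate-substitute (Γ⁺ (mirror P)) (Γ⁺ P) identity-homo barGenerator σ-unmirror

-- The mix of a chiral polytope with its dual

proposition5p2 : ∀ {n : ℕ} (P : ChiralPolytope n) → Finite P →
    ∀ {a b : ℕ} → HasOrder (Γ⁺ P □ Γ⁺ (P ᵟ)) a → HasOrder (Γ⁺ P □ Γ⁺ (mirror P)) b →
    a > b → MixIsChiral P (P ᵟ)
proposition5p2 {n} P (m , faces) orderₐ order-b a>b (bar-N⊆N , _) = ℕ.<⇒≱ a>b
  (comix-order-≤ (Γ⁺ P) (Γ⁺ (P ᵟ)) (Γ⁺ (mirror P)) (λ {w} → kernels {w})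
    (bar ∘ delta) bar∘delta-injective code code-injective orderₐ order-b)
  where
  module P = ChiralPolytope P
  module Γ⁺P = MarkedGroup (Γ⁺ P)
  module Γ⁺D = MarkedGroup (Γ⁺ (P ᵟ))
  module Γ⁺M = MarkedGroup (Γ⁺ (mirror P))
  module Faces = Inverse faces

  _≟_ : DecidableEquality P.Face
  _≟_ = via-injection (↔⇒↣ faces) Fin._≟_

  actᴰ : Word (Fin (n ∸ 1)) → P.Face → P.Face
  actᴰ w = ChiralPolytope.to (P ᵟ) (Γ⁺D.evaluate w)

  -- For `w` in N, `bar w` lies in N and hence in M; by `evaluate-mirror` this puts `w` into M̄.
  kernels : ∀ {w} → Γ⁺P.Kernel w → Γ⁺D.Kernel w → Γ⁺M.Kernel w
  kernels {w} p q F = trans (evaluate-mirror P _≟_ w F)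
    (proj₁ (mix-kernel⁻ (Γ⁺ P) (Γ⁺ (P ᵟ)) {bar w}
      (bar-N⊆N (w , mix-kernel⁺ (Γ⁺ P) (Γ⁺ (P ᵟ)) {w} p q , reflexive))) F)

  -- The dual and the mirror image have the same rotations of the faces; `bar ∘ delta` rewrites a
  -- word of the one as a word of the other.
  bar∘delta : ∀ w F → actᴰ w F ≡ P.to (Γ⁺M.evaluate (bar (delta w))) F
  bar∘delta w F = trans (evaluate-dual P _≟_ w F) (evaluate-unmirror P _≟_ (delta w) F)

  bar∘delta-injective : ∀ u v → Γ⁺M.evaluate (bar (delta u)) Γ⁺M.≋ Γ⁺M.evaluate (bar (delta v)) →
                        Γ⁺D.evaluate u Γ⁺D.≋ Γ⁺D.evaluate v
  bar∘delta-injective u v e F = trans (bar∘delta u F) (trans (e F) (sym (bar∘delta v F)))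

  -- A rotation is coded by its value table on the `m` faces, one of `m ^ m` tables.
  code : Word (Fin (n ∸ 1)) → Fin (m ℕ.^ m)
  code w = funToFin (Faces.to ∘ actᴰ w ∘ Faces.from)

  code-injective : ∀ u v → code u ≡ code v → Γ⁺D.evaluate u Γ⁺D.≋ Γ⁺D.evaluate v
  code-injective u v e F = trans (decode u) (trans (cong (λ c → Faces.from (finToFun c (Faces.to F))) e)
    (sym (decode v)))
    where
    decode : ∀ w → actᴰ w F ≡ Faces.from (finToFun (code w) (Faces.to F))
    decode w = sym (trans (cong Faces.from (Fin.finToFun-funToFin (Faces.to ∘ actᴰ w ∘ Faces.from) (Faces.to F)))
      (trans (Faces.strictlyInverseʳ _) (cong (actᴰ w) (Faces.strictlyInverseʳ F))))
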